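{- $\alpha(W_{5}^{\Box 3}\Box K_3) = 170$.
   Context: All graphs are finite and simple. $W_{5}$ denotes the $5$-wheel, the join of the cycle $C_{5}$ with a single vertex $K_1$ (so $W_5$ has $6$ vertices). The Cartesian product $G \Box H$ has vertex set $V(G)\times V(H)$, with $(u,x)$ adjacent to $(v,y)$ if and only if either $u=v$ and $xy\in E(H)$, or $x=y$ and $uv\in E(G)$. Set $G^{\Box 1}=G$ and $G^{\Box k}=G^{\Box (k-1)}\Box G$ for $k\ge 2$. $\alpha(G)$ is the independence number of $G$, and $K_3$ is the complete graph on $3$ vertices. -}

module Defs where

open import Data.Fin using (Fin; toℕ)
import Data.Fin.Properties as Fin
open import Data.Fin.Subset using (Subset; _∈_; ∣_∣; inside; outside)
open import Data.Fin.Subset.Properties using (_∈?_)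
open import Data.List using (List; [_]; _++_; map; filter)
open import Data.List.Extrema.Nat using (max)
open import Data.Nat using (ℕ; zero; suc; _+_; _*_; _≤?_; NonZero)
import Data.Nat.Properties as ℕ
open import Data.Product using (_×_; _,_)
open import Data.Product.Function.NonDependent.Propositional using (_×-↔_)
open import Data.Sum using (_⊎_; inj₁; inj₂; swap)
open import Data.Sum.Function.Propositional using (_⊎-↔_)
open import Data.Unit using (⊤; tt)
import Data.Vec as Vec
open import Function using (_↔_; Inverse)
open import Function.Construct.Composition using (_↔-∘_)
open import Function.Construct.Identity using (↔-id)
open import Function.Construct.Symmetry using (↔-sym)
open import Function.Properties.Inverse using (↔⇒↣)
open import Level using (0ℓ)
open import Relation.Binary.Core using (Rel)
open import Relation.Binary.Definitions
  using (Decidable; DecidableEquality; Irreflexive; Symmetric)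
open import Relation.Binary.PropositionalEquality
  using (_≡_; _≢_; refl; sym; trans; cong)
open import Relation.Nullary using (Dec; yes; no; ¬_)
open import Relation.Nullary.Decidable
  using (True; ¬?; _×-dec_; _⊎-dec_; _→-dec_; via-injection)

record Graph : Set₁ where
  infix 4 _~_ _~?_
  field
    V        : Set
    order    : ℕ
    labels   : V ↔ Fin order
    _~_      : Rel V 0ℓ
    _~?_     : Decidable _~_
    ~-sym    : Symmetric _~_
    ~-irrefl : Irreflexive _≡_ _~_

  vertex : Fin order → V
  vertex = Inverse.from labels

  _≟_ : DecidableEquality V
  _≟_ = via-injection (↔⇒↣ labels) Fin._≟_

-- A set of vertices is represented by the set of their labels.
Independent : (G : Graph) → Subset (Graph.order G) → Set
Independent G S = ∀ i → i ∈ S → ∀ j → j ∈ S → ¬ (vertex i ~ vertex j)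
  where open Graph G

independent? : (G : Graph) (S : Subset (Graph.order G)) → Dec (Independent G S)
independent? G S =
  Fin.all? λ i → (i ∈? S) →-dec
  Fin.all? λ j → (j ∈? S) →-dec ¬? (vertex i ~? vertex j)
  where open Graph G

subsets : ∀ n → List (Subset n)
subsets zero    = [ Vec.[] ]
subsets (suc n) =
  map (inside Vec.∷_) (subsets n) ++ map (outside Vec.∷_) (subsets n)

-- The empty set is independent, so the default value 0 of the maximum of an
-- empty list plays no role.
α : Graph → ℕ
α G = max 0 (map ∣_∣ (filter (independent? G) (subsets (Graph.order G))))

K : ℕ → Graph
K n = record
  { V        = Fin n
  ; order    = n
  ; labels   = ↔-id (Fin n)
  ; _~_      = _≢_
  ; _~?_     = λ i j → ¬? (i Fin.≟ j)
  ; ~-sym    = λ i≢j j≡i → i≢j (sym j≡i)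
  ; ~-irrefl = λ i≡j i≢j → i≢j i≡j
  }

Next : ∀ {n} → Fin n → Fin n → Set
Next {n} i j = (suc (toℕ i) ≡ toℕ j) ⊎ (suc (toℕ i) ≡ n × toℕ j ≡ 0)

next? : ∀ {n} → Decidable (Next {n})
next? {n} i j =
  (suc (toℕ i) ℕ.≟ toℕ j) ⊎-dec ((suc (toℕ i) ℕ.≟ n) ×-dec (toℕ j ℕ.≟ 0))

next-irrefl : ∀ {n} → True (3 ≤? n) → (i : Fin n) → ¬ Next i i
next-irrefl _ i (inj₁ eq) = ℕ.1+n≢n eq
next-irrefl t i (inj₂ (eq , i≡0)) with trans (sym eq) (cong suc i≡0)
next-irrefl () i (inj₂ (eq , i≡0)) | refl

C : (n : ℕ) {3≤n : True (3 ≤? n)} → Graph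
C n {3≤n} = record
  { V        = Fin n
  ; order    = n
  ; labels   = ↔-id (Fin n)
  ; _~_      = λ i j → Next i j ⊎ Next j i
  ; _~?_     = λ i j → next? i j ⊎-dec next? j i
  ; ~-sym    = swap
  ; ~-irrefl = λ { {i} refl (inj₁ p) → next-irrefl 3≤n i p
                 ; {i} refl (inj₂ p) → next-irrefl 3≤n i p }
  }

module _ (G H : Graph) where
  private
    module G = Graph G
    module H = Graph H

  JoinAdj : Rel (G.V ⊎ H.V) 0ℓ
  JoinAdj (inj₁ u) (inj₁ v) = u G.~ v
  JoinAdj (inj₁ _) (inj₂ _) = ⊤
  JoinAdj (inj₂ _) (inj₁ _) = ⊤
  JoinAdj (inj₂ x) (inj₂ y) = x H.~ y

  joinAdj? : Decidable JoinAdj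
  joinAdj? (inj₁ u) (inj₁ v) = u G.~? v
  joinAdj? (inj₁ _) (inj₂ _) = yes tt
  joinAdj? (inj₂ _) (inj₁ _) = yes tt
  joinAdj? (inj₂ x) (inj₂ y) = x H.~? y

  joinAdj-sym : Symmetric JoinAdj
  joinAdj-sym {inj₁ _} {inj₁ _} p = G.~-sym p
  joinAdj-sym {inj₁ _} {inj₂ _} _ = tt
  joinAdj-sym {inj₂ _} {inj₁ _} _ = tt
  joinAdj-sym {inj₂ _} {inj₂ _} p = H.~-sym p

  joinAdj-irrefl : Irreflexive _≡_ JoinAdj
  joinAdj-irrefl {inj₁ _} refl p = G.~-irrefl refl p
  joinAdj-irrefl {inj₂ _} refl p = H.~-irrefl refl p

  join : Graph
  join = record
    { V        = G.V ⊎ H.V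
    ; order    = G.order + H.order
    ; labels   = ↔-sym Fin.+↔⊎ ↔-∘ (G.labels ⊎-↔ H.labels)
    ; _~_      = JoinAdj
    ; _~?_     = joinAdj?
    ; ~-sym    = λ {p} {q} → joinAdj-sym {p} {q}
    ; ~-irrefl = λ {p} {q} → joinAdj-irrefl {p} {q}
    }

  BoxAdj : Rel (G.V × H.V) 0ℓ
  BoxAdj (u , x) (v , y) = (u ≡ v × x H.~ y) ⊎ (x ≡ y × u G.~ v)

  boxAdj? : Decidable BoxAdj
  boxAdj? (u , x) (v , y) =
    ((u G.≟ v) ×-dec (x H.~? y)) ⊎-dec ((x H.≟ y) ×-dec (u G.~? v))

  boxAdj-sym : Symmetric BoxAdj
  boxAdj-sym (inj₁ (u≡v , x~y)) = inj₁ (sym u≡v , H.~-sym x~y)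
  boxAdj-sym (inj₂ (x≡y , u~v)) = inj₂ (sym x≡y , G.~-sym u~v)

  boxAdj-irrefl : Irreflexive _≡_ BoxAdj
  boxAdj-irrefl refl (inj₁ (_ , x~x)) = H.~-irrefl refl x~x
  boxAdj-irrefl refl (inj₂ (_ , u~u)) = G.~-irrefl refl u~u

  infixl 6 _□_
  _□_ : Graph
  _□_ = record
    { V        = G.V × H.V
    ; order    = G.order * H.order
    ; labels   = ↔-sym Fin.*↔× ↔-∘ (G.labels ×-↔ H.labels)
    ; _~_      = BoxAdj
    ; _~?_     = boxAdj?
    ; ~-sym    = boxAdj-sym
    ; ~-irrefl = boxAdj-irrefl
    }

W₅ : Graph
W₅ = join (C 5) (K 1)

infixl 7 _^□_
_^□_ : Graph → (k : ℕ) → .{{NonZero k}} → Graph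
G ^□ suc zero    = G
G ^□ suc (suc k) = (G ^□ suc k) □ G

-- A set of vertices of H □ K 3 is independent iff it is a proper 3-colouring of a subset of H, so the theorem
-- says that a partial proper 3-colouring of W₅ □ W₅ □ W₅ leaves at least 46 of the 216 vertices uncoloured, and
-- that 46 is attained.  Suppose at most 45 are uncoloured.  Every copy of W₅ has an uncoloured vertex, and every
-- layer W₅ □ W₅ has at least 7.  So in each of the three directions at most 3 of the 6 layers have more than 7
-- uncoloured vertices, whence two adjacent layers in the first direction have exactly 7.  There are 6600
-- colourings of W₅ □ W₅ with 7 uncoloured vertices, eleven up to rotations, reflections and permutations of the
-- colours.  For one of the two layers running through these eleven, the other layer and the layers with 7
-- uncoloured vertices in the other two directions are enumerated; what remains of the colouring is then
-- bounded below layer by layer and, if necessary, completed by exhaustive search.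
module Submission where

open import Defs
open import Data.Bool using (Bool; true; false; if_then_else_; _∧_; _∨_; not)
import Data.Bool as Bool
open import Data.Bool.ListAction using (all; any)
open import Data.Bool.Properties using (T-≡)
open import Data.Empty using (⊥; ⊥-elim)
open import Data.Fin using (Fin; zero; suc; combine; remQuot; _↑ˡ_; _↑ʳ_)
open import Data.Fin.Patterns
import Data.Fin.Properties as Fin
open import Data.Fin.Subset using (Subset; ∣_∣; inside; outside)
import Data.Fin.Subset as Sub
open import Data.List using (List; []; _∷_; _++_; concatMap; map; filterᵇ; null)
open import Data.List.Extrema.Nat using (max≤v⁺; v≤max⁺)
open import Data.List.Membership.Propositional using (_∈_; lose; find)
open import Data.List.Membership.Propositional.Properties using (∈-concatMap⁺; ∈-map⁺; ∈-filter⁺; ∈-++⁺ˡ; ∈-++⁺ʳ)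
import Data.List.Relation.Unary.All as All
import Data.List.Relation.Unary.All.Properties as All
open import Data.List.Relation.Unary.Any using (here; there)
import Data.List.Relation.Unary.Any.Properties as Any
open import Data.Maybe using (Maybe; just; nothing; maybe′)
open import Data.Nat using (ℕ; zero; suc; _+_; _∸_; _*_; _⊓_; _≤_; z≤n; s≤s; _≤ᵇ_; _<ᵇ_; _≡ᵇ_; nonZero)
import Data.Nat.Properties as ℕ
open import Data.Nat.Solver using (module +-*-Solver)
open import Data.Product using (_×_; _,_; proj₁; proj₂; ∃)
open import Data.Sum using (_⊎_; inj₁; inj₂; [_,_]′)
open import Data.Vec using ([]; _∷_; lookup; tabulate)
import Data.Vec.Properties as Vec
open import Function using (_∘_; id; Equivalence; Inverse)
open import Relation.Binary.PropositionalEquality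
open import Relation.Nullary using (contradiction)
open import Relation.Nullary.Decidable using (T?; toWitness; _→-dec_)

open import Algebra.Properties.CommutativeSemigroup ℕ.+-commutativeSemigroup using (interchange)

-- Families indexed by the vertices of W₅

-- An uncoloured vertex has weight 1, and the theorem is a lower bound for a total weight. The
-- constants arise as follows. The value 7 for a layer comes from the enumeration itself: colourings
-- of weight at most 7 are listed, and none of them weighs less. Six layers then weigh at least 42,
-- so a total of at most 45 leaves an excess of 3 in every direction. Three layers of weight 7 must
-- contain an adjacent pair because W₅ has no three pairwise nonadjacent vertices. The obstacle is
-- size: everything has to be decided by evaluation during type checking. Fixing two adjacent layers
-- makes this feasible, since a layer in another direction meets each of them in a line. If it has
-- weight 7, it is an entry of the list with two prescribed rows, and few entries have these. The
-- heavier layers stay undetermined. All soundness arguments have one shape. A search returns a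
-- list, a completeness lemma places every admissible object in that list, and a Boolean test
-- evaluated on the list gives the contradiction.

data Ix : Set where
  i0 i1 i2 i3 i4 hub : Ix

data Six (A : Set) : Set where
  six : (a b c d e h : A) → Six A

private variable
  A B S : Set

at : Six A → Ix → A
at (six a b c d e h) i0  = a
at (six a b c d e h) i1  = b
at (six a b c d e h) i2  = c
at (six a b c d e h) i3  = d
at (six a b c d e h) i4  = e
at (six a b c d e h) hub = h

tab : (Ix → A) → Six A
tab f = six (f i0) (f i1) (f i2) (f i3) (f i4) (f hub)

zip6 : {C : Set} → (A → B → C) → Six A → Six B → Six C
zip6 f (six a b c d e h) (six a′ b′ c′ d′ e′ h′) =
  six (f a a′) (f b b′) (f c c′) (f d d′) (f e e′) (f h h′)

map6 : (A → B) → Six A → Six B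
map6 f (six a b c d e h) = six (f a) (f b) (f c) (f d) (f e) (f h)

constant : A → Six A
constant a = six a a a a a a

-- The summands stand in the order in which the searches choose them, the hub first, so that
-- spending a budget along a search matches this sum by associativity alone.
total : Six ℕ → ℕ
total (six a b c d e h) = h + (a + (b + (c + (d + e))))

Σ₆ : (Ix → ℕ) → ℕ
Σ₆ f = total (tab f)

at-tab : (f : Ix → A) (i : Ix) → at (tab f) i ≡ f i
at-tab f i0  = refl
at-tab f i1  = refl
at-tab f i2  = refl
at-tab f i3  = refl
at-tab f i4  = refl
at-tab f hub = refl

at-map6 : (f : A → B) (s : Six A) (i : Ix) → at (map6 f s) i ≡ f (at s i)
at-map6 f (six a b c d e h) i0  = refl
at-map6 f (six a b c d e h) i1  = refl
at-map6 f (six a b c d e h) i2  = refl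
at-map6 f (six a b c d e h) i3  = refl
at-map6 f (six a b c d e h) i4  = refl
at-map6 f (six a b c d e h) hub = refl

at-zip6 : {C : Set} (f : A → B → C) (s : Six A) (t : Six B) (i : Ix) →
          at (zip6 f s t) i ≡ f (at s i) (at t i)
at-zip6 f (six a b c d e h) (six a′ b′ c′ d′ e′ h′) i0  = refl
at-zip6 f (six a b c d e h) (six a′ b′ c′ d′ e′ h′) i1  = refl
at-zip6 f (six a b c d e h) (six a′ b′ c′ d′ e′ h′) i2  = refl
at-zip6 f (six a b c d e h) (six a′ b′ c′ d′ e′ h′) i3  = refl
at-zip6 f (six a b c d e h) (six a′ b′ c′ d′ e′ h′) i4  = refl
at-zip6 f (six a b c d e h) (six a′ b′ c′ d′ e′ h′) hub = refl

at-constant : (a : A) (i : Ix) → at (constant a) i ≡ a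
at-constant a i0  = refl
at-constant a i1  = refl
at-constant a i2  = refl
at-constant a i3  = refl
at-constant a i4  = refl
at-constant a hub = refl

tab-at : (s : Six A) → tab (at s) ≡ s
tab-at (six a b c d e h) = refl

six-ext : {s t : Six A} → (∀ i → at s i ≡ at t i) → s ≡ t
six-ext {s = six _ _ _ _ _ _} {six _ _ _ _ _ _} eq
  with refl ← eq i0 | refl ← eq i1 | refl ← eq i2 | refl ← eq i3 | refl ← eq i4 | refl ← eq hub = refl

tab-cong : {f g : Ix → A} → (∀ i → f i ≡ g i) → tab f ≡ tab g
tab-cong {f = f} {g} eq = six-ext λ i → trans (at-tab f i) (trans (eq i) (sym (at-tab g i)))

total-mono : {s t : Six ℕ} → (∀ i → at s i ≤ at t i) → total s ≤ total t
total-mono {six _ _ _ _ _ _} {six _ _ _ _ _ _} le =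
  ℕ.+-mono-≤ (le hub) (ℕ.+-mono-≤ (le i0) (ℕ.+-mono-≤ (le i1)
    (ℕ.+-mono-≤ (le i2) (ℕ.+-mono-≤ (le i3) (le i4)))))

Σ₆-mono : {f g : Ix → ℕ} → (∀ i → f i ≤ g i) → Σ₆ f ≤ Σ₆ g
Σ₆-mono {f} {g} le =
  total-mono λ i → subst₂ _≤_ (sym (at-tab f i)) (sym (at-tab g i)) (le i)

Σ₆-cong : {f g : Ix → ℕ} → (∀ i → f i ≡ g i) → Σ₆ f ≡ Σ₆ g
Σ₆-cong eq = cong total (tab-cong eq)

Σ₆-distrib-+ : (f g : Ix → ℕ) → Σ₆ (λ i → f i + g i) ≡ Σ₆ f + Σ₆ g
Σ₆-distrib-+ f g = sym
  (trans (interchange (f hub) _ (g hub) _) (cong (f hub + g hub +_)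
  (trans (interchange (f i0) _ (g i0) _) (cong (f i0 + g i0 +_)
  (trans (interchange (f i1) _ (g i1) _) (cong (f i1 + g i1 +_)
  (trans (interchange (f i2) _ (g i2) _) (cong (f i2 + g i2 +_)
  (interchange (f i3) _ (g i3) _)))))))))

Σ₆-comm : (f : Ix → Ix → ℕ) → Σ₆ (λ i → Σ₆ (f i)) ≡ Σ₆ (λ j → Σ₆ (λ i → f i j))
Σ₆-comm f = sym (trans (Σ₆-distrib-+ (f hub) s₀) (cong (Σ₆ (f hub) +_)
  (trans (Σ₆-distrib-+ (f i0) s₁) (cong (Σ₆ (f i0) +_)
  (trans (Σ₆-distrib-+ (f i1) s₂) (cong (Σ₆ (f i1) +_)
  (trans (Σ₆-distrib-+ (f i2) s₃) (cong (Σ₆ (f i2) +_)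
  (Σ₆-distrib-+ (f i3) (f i4))))))))))
  where
  s₃ s₂ s₁ s₀ : Ix → ℕ
  s₃ j = f i3 j + f i4 j
  s₂ j = f i2 j + s₃ j
  s₁ j = f i1 j + s₂ j
  s₀ j = f i0 j + s₁ j

f≤Σ₆ : (f : Ix → ℕ) (i : Ix) → f i ≤ Σ₆ f
f≤Σ₆ f hub = ℕ.m≤m+n _ _
f≤Σ₆ f i0  = ℕ.m≤n⇒m≤o+n (f hub) (ℕ.m≤m+n _ _)
f≤Σ₆ f i1  = ℕ.m≤n⇒m≤o+n (f hub) (ℕ.m≤n⇒m≤o+n (f i0) (ℕ.m≤m+n _ _))
f≤Σ₆ f i2  = ℕ.m≤n⇒m≤o+n (f hub) (ℕ.m≤n⇒m≤o+n (f i0) (ℕ.m≤n⇒m≤o+n (f i1) (ℕ.m≤m+n _ _)))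
f≤Σ₆ f i3  = ℕ.m≤n⇒m≤o+n (f hub) (ℕ.m≤n⇒m≤o+n (f i0) (ℕ.m≤n⇒m≤o+n (f i1)
               (ℕ.m≤n⇒m≤o+n (f i2) (ℕ.m≤m+n _ _))))
f≤Σ₆ f i4  = ℕ.m≤n⇒m≤o+n (f hub) (ℕ.m≤n⇒m≤o+n (f i0) (ℕ.m≤n⇒m≤o+n (f i1)
               (ℕ.m≤n⇒m≤o+n (f i2) (ℕ.m≤n+m (f i4) (f i3)))))

adj : Ix → Ix → Bool
adj hub hub = false
adj hub _   = true
adj _   hub = true
adj i0  i1  = true
adj i1  i2  = true
adj i2  i3  = true
adj i3  i4  = true
adj i4  i0  = true
adj i1  i0  = true
adj i2  i1  = true
adj i3  i2  = true
adj i4  i3  = true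
adj i0  i4  = true
adj _   _   = false

-- Exhaustive search over families on W₅

Wheel : (A → A → Bool) → (Ix → A) → Set
Wheel ok g = ∀ i j → adj i j ≡ true → ok (g i) (g j) ≡ true

ok6 : (A → B → Bool) → Six A → Six B → Bool
ok6 ok (six a b c d e h) (six a′ b′ c′ d′ e′ h′) =
  ok a a′ ∧ (ok b b′ ∧ (ok c c′ ∧ (ok d d′ ∧ (ok e e′ ∧ ok h h′))))

ok6⁺ : (ok : A → B → Bool) {s : Six A} {t : Six B} →
       (∀ i → ok (at s i) (at t i) ≡ true) → ok6 ok s t ≡ true
ok6⁺ ok {six _ _ _ _ _ _} {six _ _ _ _ _ _} p
  rewrite p i0 | p i1 | p i2 | p i3 | p i4 | p hub = refl

data Found (A S : Set) : Set where
  found : Six A → S → Found A S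

module Search {A S : Set} (ok : A → A → Bool) (step : Ix → A → S → Maybe S) where

  each : (A → Bool) → Ix → S → (A → S → List B) → List A → List B
  each p i s k = concatMap λ x →
    if p x then maybe′ (k x) [] (step i x s) else []

  -- The hub is adjacent to every other vertex, so choosing it first prunes most. Each of the ten
  -- edges of W₅ is tested as soon as both of its ends are chosen.
  search : Six (List A) → S → List (Found A S)
  search (six la lb lc ld le lh) s =
    each (λ _ → true) hub s (λ h s →
    each (ok h) i0 s (λ a s →
    each (λ x → ok a x ∧ ok h x) i1 s (λ b s →
    each (λ x → ok b x ∧ ok h x) i2 s (λ c s →
    each (λ x → ok c x ∧ ok h x) i3 s (λ d s →
    each (λ x → ok d x ∧ (ok a x ∧ ok h x)) i4 s (λ e s →
    found (six a b c d e h) s ∷ []) le) ld) lc) lb) la) lh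

  each⁺ : {p : A → Bool} {i : Ix} {s s′ : S} {k : A → S → List B} {xs : List A} {x : A} {y : B} →
          x ∈ xs → p x ≡ true → step i x s ≡ just s′ → y ∈ k x s′ → y ∈ each p i s k xs
  each⁺ {p = p} {i} {s} {s′} {k} {x = x} {y} x∈ px st y∈ = ∈-concatMap⁺ _ (lose x∈ y∈if)
    where
    y∈if : y ∈ (if p x then maybe′ (k x) [] (step i x s) else [])
    y∈if rewrite px | st = y∈

  -- The caller supplies the states along the path of `g`; pruning has to be justified on this
  -- single path only.
  search⁺ : {l : Six (List A)} {g : Ix → A} → (∀ i → g i ∈ at l i) → Wheel ok g →
            {s₀ s₁ s₂ s₃ s₄ s₅ s₆ : S} →
            step hub (g hub) s₀ ≡ just s₁ → step i0 (g i0) s₁ ≡ just s₂ →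
            step i1 (g i1) s₂ ≡ just s₃ → step i2 (g i2) s₃ ≡ just s₄ →
            step i3 (g i3) s₄ ≡ just s₅ → step i4 (g i4) s₅ ≡ just s₆ →
            found (tab g) s₆ ∈ search l s₀
  search⁺ {six _ _ _ _ _ _} {g} g∈ w e₁ e₂ e₃ e₄ e₅ e₆ =
    each⁺ (g∈ hub) refl e₁ (
    each⁺ (g∈ i0) (w hub i0 refl) e₂ (
    each⁺ (g∈ i1) (cong₂ _∧_ (w i0 i1 refl) (w hub i1 refl)) e₃ (
    each⁺ (g∈ i2) (cong₂ _∧_ (w i1 i2 refl) (w hub i2 refl)) e₄ (
    each⁺ (g∈ i3) (cong₂ _∧_ (w i2 i3 refl) (w hub i3 refl)) e₅ (
    each⁺ (g∈ i4) (cong₂ _∧_ (w i3 i4 refl) (cong₂ _∧_ (w i0 i4 refl) (w hub i4 refl))) e₆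
    (here refl))))))

guard : Bool → A → Maybe A
guard true  a = just a
guard false a = nothing

≤⇒≤ᵇ≡true : {m n : ℕ} → m ≤ n → (m ≤ᵇ n) ≡ true
≤⇒≤ᵇ≡true m≤n = Equivalence.to T-≡ (ℕ.≤⇒≤ᵇ m≤n)

data Weighted (A : Set) : Set where
  wt : A → ℕ → Weighted A

item : Weighted A → A
item (wt a _) = a

weight : Weighted A → ℕ
weight (wt _ n) = n

module Bounded {A : Set} (ok : A → A → Bool) where

  spend : Six ℕ → Ix → Weighted A → ℕ → Maybe ℕ
  spend m i (wt _ n) s = guard ((n ∸ at m i) ≤ᵇ s) (s ∸ (n ∸ at m i))

  collect : Found (Weighted A) ℕ → Weighted (Six A)
  collect (found s _) = wt (map6 item s) (total (map6 weight s))

  ok′ : Weighted A → Weighted A → Bool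
  ok′ x y = ok (item x) (item y)

  -- Branch and bound, used for rows made of colours, planes made of rows, cubes made of planes, and
  -- families of layers. The entries of `m` are lower bounds, and the state is the slack by which
  -- the weights still to be chosen may exceed them. One coordinate can absorb at most the whole
  -- slack `s`, so its candidates are generated only up to `n + s`.
  bounded : Six ℕ → Six (ℕ → List (Weighted A)) → ℕ → List (Weighted (Six A))
  bounded m l b = if total m ≤ᵇ b then go (b ∸ total m) else []
    where
    go : ℕ → List (Weighted (Six A))
    go s = map collect (Search.search ok′ (spend m) (zip6 (λ n f → f (n + s)) m l) s)

  module _ (m : Six ℕ) (l : Six (ℕ → List (Weighted A))) {g : Ix → A} {w : Ix → ℕ}
           (m≤w : ∀ i → at m i ≤ w i)
           (g∈ : ∀ i {b} → w i ≤ b → wt (g i) (w i) ∈ at l i b)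
           (wheel : Wheel ok g) where

    private
      cost : Ix → ℕ
      cost i = w i ∸ at m i

      spend⁺ : ∀ i r → spend m i (wt (g i) (w i)) (cost i + r) ≡ just r
      spend⁺ i r rewrite ≤⇒≤ᵇ≡true (ℕ.m≤m+n (cost i) r) | ℕ.m+n∸m≡n (cost i) r = refl

      split : ∀ i → at m i + cost i ≡ w i
      split i = ℕ.m+[n∸m]≡n (m≤w i)

      total-split : total m + Σ₆ cost ≡ Σ₆ w
      total-split = trans (cong (λ z → total z + Σ₆ cost) (sym (tab-at m)))
        (trans (sym (Σ₆-distrib-+ (at m) cost)) (Σ₆-cong split))

    bounded⁺ : {b : ℕ} → Σ₆ w ≤ b → wt (tab g) (Σ₆ w) ∈ bounded m l b
    bounded⁺ {b} le = goal
      where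
      m≤b : total m ≤ b
      m≤b = ℕ.≤-trans (ℕ.m≤m+n _ (Σ₆ cost)) (ℕ.≤-trans (ℕ.≤-reflexive total-split) le)

      rest : ℕ
      rest = b ∸ Σ₆ w

      to-b : total m + (Σ₆ cost + rest) ≡ b
      to-b = trans (sym (ℕ.+-assoc (total m) _ rest))
        (trans (cong (_+ rest) total-split) (ℕ.m+[n∸m]≡n le))

      slack≡ : b ∸ total m ≡ Σ₆ cost + rest
      slack≡ = trans (cong (_∸ total m) (sym to-b)) (ℕ.m+n∸m≡n (total m) _)

      -- The slack left after each choice: `r₀` after the hub, then down to `rest` after `i4`.
      r₀ r₁ r₂ r₃ r₄ : ℕ
      r₄ = cost i4 + rest
      r₃ = cost i3 + r₄
      r₂ = cost i2 + r₃
      r₁ = cost i1 + r₂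
      r₀ = cost i0 + r₁

      reassoc : Σ₆ cost + rest ≡ cost hub + r₀
      reassoc =
        trans (ℕ.+-assoc (cost hub) _ rest) (cong (cost hub +_)
        (trans (ℕ.+-assoc (cost i0) _ rest) (cong (cost i0 +_)
        (trans (ℕ.+-assoc (cost i1) _ rest) (cong (cost i1 +_)
        (trans (ℕ.+-assoc (cost i2) _ rest) (cong (cost i2 +_)
        (ℕ.+-assoc (cost i3) _ rest))))))))

      cost≤slack : ∀ i → cost i ≤ b ∸ total m
      cost≤slack i = ℕ.≤-trans (f≤Σ₆ cost i)
        (ℕ.≤-trans (ℕ.m≤m+n _ rest) (ℕ.≤-reflexive (sym slack≡)))

      within : ∀ i → wt (g i) (w i) ∈ at (zip6 (λ n f → f (n + (b ∸ total m))) m l) i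
      within i = subst (wt (g i) (w i) ∈_) (sym (at-zip6 _ m l i))
        (g∈ i (ℕ.≤-trans (ℕ.≤-reflexive (sym (split i))) (ℕ.+-monoʳ-≤ (at m i) (cost≤slack i))))

      start : spend m hub (wt (g hub) (w hub)) (b ∸ total m) ≡ just r₀
      start = subst (λ s → spend m hub (wt (g hub) (w hub)) s ≡ just r₀)
        (sym (trans slack≡ reassoc)) (spend⁺ hub r₀)

      goal : wt (tab g) (Σ₆ w) ∈ bounded m l b
      goal rewrite ≤⇒≤ᵇ≡true m≤b =
        ∈-map⁺ collect {x = found (tab λ i → wt (g i) (w i)) rest}
          (Search.search⁺ ok′ (spend m) {l = zip6 (λ n f → f (n + (b ∸ total m))) m l} {g = λ i → wt (g i) (w i)} within wheel start
            (spend⁺ i0 r₁) (spend⁺ i1 r₂) (spend⁺ i2 r₃) (spend⁺ i3 r₄) (spend⁺ i4 rest))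

-- Colourings of W₅ and of W₅ □ W₅

∧⁻ : {a b : Bool} → a ∧ b ≡ true → a ≡ true × b ≡ true
∧⁻ {true} {true} _ = refl , refl

ok6⁻ : {A B : Set} (ok : A → B → Bool) {s : Six A} {t : Six B} →
       ok6 ok s t ≡ true → ∀ i → ok (at s i) (at t i) ≡ true
ok6⁻ ok {six a b c d e h} {six a′ b′ c′ d′ e′ h′} p with ∧⁻ {ok a a′} p
... | pa , q with ∧⁻ {ok b b′} q
... | pb , q with ∧⁻ {ok c c′} q
... | pc , q with ∧⁻ {ok d d′} q
... | pd , q with ∧⁻ {ok e e′} q
... | pe , ph = λ { i0 → pa ; i1 → pb ; i2 → pc ; i3 → pd ; i4 → pe ; hub → ph }

all⇒ : (p : A → Bool) {xs : List A} {x : A} → all p xs ≡ true → x ∈ xs → p x ≡ true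
all⇒ p eq x∈ = Equivalence.to T-≡ (All.lookup (All.all⁺ p _ (Equivalence.from T-≡ eq)) x∈)

any⇒ : (p : A → Bool) (xs : List A) → any p xs ≡ true → ∃ λ x → x ∈ xs × p x ≡ true
any⇒ p xs eq with find (Any.any⁻ p xs (Equivalence.from T-≡ eq))
... | x , x∈ , px = x , x∈ , Equivalence.to T-≡ px

filter⇒ : (p : A → Bool) {xs : List A} {x : A} → x ∈ xs → p x ≡ true → x ∈ filterᵇ p xs
filter⇒ p x∈ px = ∈-filter⁺ (T? ∘ p) x∈ (Equivalence.from T-≡ px)

ix : Six Ix
ix = six i0 i1 i2 i3 i4 hub

at-ix : ∀ i → at ix i ≡ i
at-ix = at-tab id

allIx : (Ix → Bool) → Bool
allIx p = ok6 (λ i _ → p i) ix ix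

allIx⇒ : (p : Ix → Bool) → allIx p ≡ true → ∀ i → p i ≡ true
allIx⇒ p eq i = subst (λ j → p j ≡ true) (at-ix i) (ok6⁻ (λ i _ → p i) {ix} {ix} eq i)

-- `c0` marks an uncoloured vertex: it conflicts with nothing and is the only value of weight 1.
data Color : Set where
  c0 c1 c2 c3 : Color

okC : Color → Color → Bool
okC c1 c1 = false
okC c2 c2 = false
okC c3 c3 = false
okC _  _  = true

eqC : Color → Color → Bool
eqC c0 c0 = true
eqC c1 c1 = true
eqC c2 c2 = true
eqC c3 c3 = true
eqC _  _  = false

eqC⇒≡ : ∀ {a b} → eqC a b ≡ true → a ≡ b
eqC⇒≡ {c0} {c0} _ = refl
eqC⇒≡ {c1} {c1} _ = refl
eqC⇒≡ {c2} {c2} _ = refl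
eqC⇒≡ {c3} {c3} _ = refl

wC : Color → ℕ
wC c0 = 1
wC c1 = 0
wC c2 = 0
wC c3 = 0

Row Plane : Set
Row   = Six Color
Plane = Six Row

okR : Row → Row → Bool
okR = ok6 okC

okP : Plane → Plane → Bool
okP = ok6 okR

Proper₁ : (Ix → Color) → Set
Proper₁ = Wheel okC

Proper₂ : (Ix → Ix → Color) → Set
Proper₂ g = (∀ y → Proper₁ (g y)) × (∀ z → Proper₁ (λ y → g y z))

w₁ : (Ix → Color) → ℕ
w₁ r = Σ₆ (wC ∘ r)

w₂ : (Ix → Ix → Color) → ℕ
w₂ g = Σ₆ (w₁ ∘ g)

tab₂ : (Ix → Ix → A) → Six (Six A)
tab₂ g = tab (tab ∘ g)

tab-ok : {A B : Set} (ok : A → B → Bool) {r : Ix → A} {s : Ix → B} →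
         (∀ i → ok (r i) (s i) ≡ true) → ok6 ok (tab r) (tab s) ≡ true
tab-ok ok {r} {s} p = ok6⁺ ok λ i → subst₂ (λ a b → ok a b ≡ true) (sym (at-tab r i)) (sym (at-tab s i)) (p i)

at₂-tab₂ : (g : Ix → Ix → A) (y z : Ix) → at (at (tab₂ g) y) z ≡ g y z
at₂-tab₂ g y z = trans (cong (λ r → at r z) (at-tab (tab ∘ g) y)) (at-tab (g y) z)

tab₂-ok : ∀ g h → (∀ y z → okC (g y z) (h y z) ≡ true) → okP (tab₂ g) (tab₂ h) ≡ true
tab₂-ok g h p = tab-ok okR {tab ∘ g} {tab ∘ h} λ y → tab-ok okC {g y} {h y} (p y)

rows-wheel : {g : Ix → Ix → Color} → Proper₂ g → Wheel okR (tab ∘ g)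
rows-wheel {g} (_ , cols) i j a = tab-ok okC {g i} {g j} λ z → cols z i j a

weightedColors : List (Weighted Color)
weightedColors = wt c0 1 ∷ wt c1 0 ∷ wt c2 0 ∷ wt c3 0 ∷ []

∈-weightedColors : ∀ c → wt c (wC c) ∈ weightedColors
∈-weightedColors c0 = here refl
∈-weightedColors c1 = there (here refl)
∈-weightedColors c2 = there (there (here refl))
∈-weightedColors c3 = there (there (there (here refl)))

open Bounded using (bounded; bounded⁺)

rows : ℕ → List (Weighted Row)
rows = bounded okC (constant 0) (constant λ _ → weightedColors)

∈-rows : {r : Ix → Color} {b : ℕ} → Proper₁ r → w₁ r ≤ b → wt (tab r) (w₁ r) ∈ rows b
∈-rows {r} p = bounded⁺ okC (constant 0) (constant λ _ → weightedColors) {w = wC ∘ r}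
  (λ i → subst (λ n → n ≤ wC (r i)) (sym (at-constant 0 i)) z≤n)
  (λ i {b} _ → subst (λ f → wt (r i) (wC (r i)) ∈ f b)
    (sym (at-constant (λ _ → weightedColors) i)) (∈-weightedColors (r i)))
  p

-- W₅ is not 3-colourable, being an odd cycle joined to a vertex. Here this is the fact that
-- `rows 0` evaluates to the empty list.
1≤w₁ : {r : Ix → Color} → Proper₁ r → 1 ≤ w₁ r
1≤w₁ {r} p with w₁ r in eq
... | suc _ = s≤s z≤n
... | zero with () ← ∈-rows p (ℕ.≤-reflexive eq)

-- Colourings of W₅ □ W₅ with at most 7 uncoloured vertices and a given hub row

lowRows : List (Weighted Row)
lowRows = rows 2

rank : Ix → ℕ
rank hub = 1
rank i0  = 2
rank i1  = 3
rank i2  = 4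
rank i3  = 5
rank i4  = 6

-- partial t m: t vertices of the rows chosen so far are uncoloured, and m marks the columns that contain one of them.
data Partial : Set where
  partial : ℕ → Six Bool → Partial

hit : Color → Bool → Bool
hit c0 _ = true
hit _  b = b

miss : Bool → ℕ
miss true  = 0
miss false = 1

missing : Six Bool → ℕ
missing m = total (map6 miss m)

-- Each of the 6 ∸ rank i rows still to come has an uncoloured vertex, and so has each unmarked column.
step₇ : Ix → Weighted Row → Partial → Maybe Partial
step₇ i (wt r n) (partial t m) = go (n + t) (zip6 hit r m)
  where
  go : ℕ → Six Bool → Maybe Partial
  go t m = guard ((t ≤ᵇ suc (rank i)) ∧ (t + missing m ≤ᵇ 7)) (partial t m)

okW : Weighted Row → Weighted Row → Bool
okW x y = okR (item x) (item y)

wRow : Row → ℕ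
wRow r = total (map6 wC r)

-- Six rows of weight at least 1 and total weight at most 7 have only one unit to spare, so the hub
-- row and any other row together weigh at most 3.
rowsNear : Row → List (Weighted Row)
rowsNear h = filterᵇ (λ x → (weight x + wRow h ≤ᵇ 3) ∧ okR h (item x)) lowRows

withHub : Row → List (Weighted Row) → Six (List (Weighted Row))
withHub h l = six l l l l l (wt h (wRow h) ∷ [])

unweigh : Found (Weighted Row) Partial → Plane
unweigh (found p _) = map6 item p

planesWithHub : Row → List Plane
planesWithHub h = map unweigh
  (Search.search okW step₇ (withHub h (rowsNear h)) (partial 0 (constant false)))

module _ {g : Ix → Ix → Color} (proper : Proper₂ g) (small : w₂ g ≤ 7) where

  private
    w : Ix → ℕ
    w = w₁ ∘ g

    1≤w : ∀ i → 1 ≤ w i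
    1≤w i = 1≤w₁ (proj₁ proper i)

    t₁ t₂ t₃ t₄ t₅ t₆ : ℕ
    t₁ = w hub + 0
    t₂ = w i0 + t₁
    t₃ = w i1 + t₂
    t₄ = w i2 + t₃
    t₅ = w i3 + t₄
    t₆ = w i4 + t₅

    shift : ∀ n t {r} → (n + t) + r ≡ t + (n + r)
    shift n t {r} = trans (cong (_+ r) (ℕ.+-comm n t)) (ℕ.+-assoc t n r)

    e₁ : t₁ + (w i0 + (w i1 + (w i2 + (w i3 + w i4)))) ≡ w₂ g
    e₁ = cong (_+ (w i0 + (w i1 + (w i2 + (w i3 + w i4))))) (ℕ.+-identityʳ (w hub))
    e₂ : t₂ + (w i1 + (w i2 + (w i3 + w i4))) ≡ w₂ g
    e₂ = trans (shift (w i0) t₁) e₁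
    e₃ : t₃ + (w i2 + (w i3 + w i4)) ≡ w₂ g
    e₃ = trans (shift (w i1) t₂) e₂
    e₄ : t₄ + (w i3 + w i4) ≡ w₂ g
    e₄ = trans (shift (w i2) t₃) e₃
    e₅ : t₅ + w i4 ≡ w₂ g
    e₅ = trans (shift (w i3) t₄) e₄
    e₆ : t₆ ≡ w₂ g
    e₆ = trans (ℕ.+-comm (w i4) t₅) e₅

    -- The 7 is shared out as `k + n`: the rows still to come weigh at least `n`, which leaves `k`
    -- for those already chosen.
    few : ∀ {t r} k n → t + r ≡ w₂ g → n ≤ r → k + n ≡ 7 → t ≤ k
    few {t} {r} k n eq n≤r k+n≡7 = ℕ.+-cancelʳ-≤ n t k (ℕ.≤-trans (ℕ.+-monoʳ-≤ t n≤r)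
      (ℕ.≤-trans (ℕ.≤-reflexive eq) (ℕ.≤-trans small (ℕ.≤-reflexive (sym k+n≡7)))))

    m₁ m₂ m₃ m₄ m₅ m₆ : Six Bool
    m₁ = zip6 hit (tab (g hub)) (constant false)
    m₂ = zip6 hit (tab (g i0)) m₁
    m₃ = zip6 hit (tab (g i1)) m₂
    m₄ = zip6 hit (tab (g i2)) m₃
    m₅ = zip6 hit (tab (g i3)) m₄
    m₆ = zip6 hit (tab (g i4)) m₅

    miss-hit : ∀ c b → miss b ≤ wC c + miss (hit c b)
    miss-hit c0 true  = z≤n
    miss-hit c0 false = s≤s z≤n
    miss-hit c1 b = ℕ.≤-refl
    miss-hit c2 b = ℕ.≤-refl
    miss-hit c3 b = ℕ.≤-refl

    missing≡ : ∀ m → missing m ≡ Σ₆ (miss ∘ at m)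
    missing≡ (six _ _ _ _ _ _) = refl

    -- Only an uncoloured vertex marks its column, so a row lowers the number of unmarked columns by
    -- at most its own weight.
    missing-hit : ∀ (r : Ix → Color) m → missing m ≤ w₁ r + missing (zip6 hit (tab r) m)
    missing-hit r m = begin
      missing m                                       ≡⟨ missing≡ m ⟩
      Σ₆ (miss ∘ at m)                                ≤⟨ Σ₆-mono cell ⟩
      Σ₆ (λ i → wC (r i) + miss (at m′ i))            ≡⟨ Σ₆-distrib-+ (wC ∘ r) (miss ∘ at m′) ⟩
      w₁ r + Σ₆ (miss ∘ at m′)                        ≡⟨ cong (w₁ r +_) (missing≡ m′) ⟨
      w₁ r + missing m′                               ∎
      where
      open ℕ.≤-Reasoning
      m′ : Six Bool
      m′ = zip6 hit (tab r) m
      cell : ∀ i → miss (at m i) ≤ wC (r i) + miss (at m′ i)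
      cell i rewrite at-zip6 hit (tab r) m i | at-tab r i = miss-hit (r i) (at m i)

    -- Adding a row never decreases t + missing m, so the bound on the total bounds every partial choice.
    deficit : ∀ {t} (r : Ix → Color) m → (w₁ r + t) + missing (zip6 hit (tab r) m) ≤ 7 → t + missing m ≤ 7
    deficit {t} r m le = ℕ.≤-trans (ℕ.+-monoʳ-≤ t (missing-hit r m))
      (ℕ.≤-trans (ℕ.≤-reflexive (sym (shift (w₁ r) t))) le)

    hit-false : ∀ c b → hit c b ≡ false → wC c ≡ 0 × b ≡ false
    hit-false c1 b eq = refl , eq
    hit-false c2 b eq = refl , eq
    hit-false c3 b eq = refl , eq

    hit-at : ∀ (r : Ix → Color) m z → at (zip6 hit (tab r) m) z ≡ false → wC (r z) ≡ 0 × at m z ≡ false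
    hit-at r m z eq = hit-false (r z) (at m z)
      (trans (sym (trans (at-zip6 hit (tab r) m z) (cong (λ c → hit c (at m z)) (at-tab r z)))) eq)

    -- A column still unmarked after all six rows would be a fully coloured copy of W₅.
    not-missed : ∀ z → at m₆ z ≡ false → ⊥
    not-missed z eq = ℕ.<⇒≢ (1≤w₁ (proj₂ proper z)) (sym (Σ₆-cong uncoloured))
      where
      q₄ : wC (g i4 z) ≡ 0 × at m₅ z ≡ false
      q₄ = hit-at (g i4) m₅ z eq
      q₃ : wC (g i3 z) ≡ 0 × at m₄ z ≡ false
      q₃ = hit-at (g i3) m₄ z (proj₂ q₄)
      q₂ : wC (g i2 z) ≡ 0 × at m₃ z ≡ false
      q₂ = hit-at (g i2) m₃ z (proj₂ q₃)
      q₁ : wC (g i1 z) ≡ 0 × at m₂ z ≡ false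
      q₁ = hit-at (g i1) m₂ z (proj₂ q₂)
      q₀ : wC (g i0 z) ≡ 0 × at m₁ z ≡ false
      q₀ = hit-at (g i0) m₁ z (proj₂ q₁)
      uncoloured : ∀ y → wC (g y z) ≡ 0
      uncoloured i0  = proj₁ q₀
      uncoloured i1  = proj₁ q₁
      uncoloured i2  = proj₁ q₂
      uncoloured i3  = proj₁ q₃
      uncoloured i4  = proj₁ q₄
      uncoloured hub = proj₁ (hit-at (g hub) (constant false) z (proj₂ q₀))

    all-hit : ∀ z → at m₆ z ≡ true
    all-hit z with at m₆ z in eq
    ... | true  = refl
    ... | false = ⊥-elim (not-missed z eq)

    d₆ : t₆ + missing m₆ ≤ 7
    d₆ = ℕ.≤-trans (ℕ.≤-reflexive (trans (cong₂ _+_ e₆ none) (ℕ.+-identityʳ _))) small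
      where
      none : missing m₆ ≡ 0
      none = trans (missing≡ m₆) (Σ₆-cong (λ z → cong miss (all-hit z)))
    d₅ : t₅ + missing m₅ ≤ 7
    d₅ = deficit (g i4) m₅ d₆
    d₄ : t₄ + missing m₄ ≤ 7
    d₄ = deficit (g i3) m₄ d₅
    d₃ : t₃ + missing m₃ ≤ 7
    d₃ = deficit (g i2) m₃ d₄
    d₂ : t₂ + missing m₂ ≤ 7
    d₂ = deficit (g i1) m₂ d₃
    d₁ : t₁ + missing m₁ ≤ 7
    d₁ = deficit (g i0) m₁ d₂

    step : ∀ i r {t m} → w₁ r + t ≤ suc (rank i) → (w₁ r + t) + missing (zip6 hit (tab r) m) ≤ 7 →
           step₇ i (wt (tab r) (w₁ r)) (partial t m) ≡ just (partial (w₁ r + t) (zip6 hit (tab r) m))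
    step i r p q rewrite ≤⇒≤ᵇ≡true p | ≤⇒≤ᵇ≡true q = refl

    r₁ : 1 ≤ w i4
    r₁ = 1≤w i4
    r₂ : 2 ≤ w i3 + w i4
    r₂ = ℕ.+-mono-≤ (1≤w i3) r₁
    r₃ : 3 ≤ w i2 + (w i3 + w i4)
    r₃ = ℕ.+-mono-≤ (1≤w i2) r₂
    r₄ : 4 ≤ w i1 + (w i2 + (w i3 + w i4))
    r₄ = ℕ.+-mono-≤ (1≤w i1) r₃
    r₅ : 5 ≤ w i0 + (w i1 + (w i2 + (w i3 + w i4)))
    r₅ = ℕ.+-mono-≤ (1≤w i0) r₄

    x : Ix → ℕ
    x i = w i ∸ 1

    1+x : ∀ i → 1 + x i ≡ w i
    1+x i = ℕ.m+[n∸m]≡n (1≤w i)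

    Σx≤1 : Σ₆ x ≤ 1
    Σx≤1 = ℕ.+-cancelˡ-≤ 6 (Σ₆ x) 1 (ℕ.≤-trans
      (ℕ.≤-reflexive (trans (sym (Σ₆-distrib-+ (λ _ → 1) x)) (Σ₆-cong 1+x))) small)

  w₁≤2 : ∀ i → w₁ (g i) ≤ 2
  w₁≤2 i = subst (_≤ 2) (1+x i) (s≤s (ℕ.≤-trans (f≤Σ₆ x i) Σx≤1))

  private
    with-hub : ∀ i → adj hub i ≡ true → (f : Ix → ℕ) → f hub + f i ≤ Σ₆ f
    with-hub i0 _ f = ℕ.+-monoʳ-≤ (f hub) (ℕ.m≤m+n _ _)
    with-hub i1 _ f = ℕ.+-monoʳ-≤ (f hub) (ℕ.m≤n⇒m≤o+n (f i0) (ℕ.m≤m+n _ _))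
    with-hub i2 _ f = ℕ.+-monoʳ-≤ (f hub) (ℕ.m≤n⇒m≤o+n (f i0) (ℕ.m≤n⇒m≤o+n (f i1) (ℕ.m≤m+n _ _)))
    with-hub i3 _ f = ℕ.+-monoʳ-≤ (f hub) (ℕ.m≤n⇒m≤o+n (f i0) (ℕ.m≤n⇒m≤o+n (f i1)
                        (ℕ.m≤n⇒m≤o+n (f i2) (ℕ.m≤m+n _ _))))
    with-hub i4 _ f = ℕ.+-monoʳ-≤ (f hub) (ℕ.m≤n⇒m≤o+n (f i0) (ℕ.m≤n⇒m≤o+n (f i1)
                        (ℕ.m≤n⇒m≤o+n (f i2) (ℕ.m≤n+m (f i4) (f i3)))))

    pair : ∀ i → adj hub i ≡ true → w i + w hub ≤ 3
    pair i a = subst (_≤ 3) (cong₂ _+_ (1+x i) (1+x hub))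
      (ℕ.≤-trans (ℕ.≤-reflexive (cong suc (ℕ.+-suc (x i) (x hub)))) (s≤s (s≤s
        (ℕ.≤-trans (ℕ.≤-reflexive (ℕ.+-comm (x i) (x hub))) (ℕ.≤-trans (with-hub i a x) Σx≤1)))))

    near : ∀ i → adj hub i ≡ true → wt (tab (g i)) (w i) ∈ rowsNear (tab (g hub))
    near i a = filter⇒ (λ x → (weight x + wRow (tab (g hub)) ≤ᵇ 3) ∧ okR (tab (g hub)) (item x))
      {xs = lowRows} {x = wt (tab (g i)) (w i)} (∈-rows (proj₁ proper i) (w₁≤2 i))
      (cong₂ _∧_ (≤⇒≤ᵇ≡true (pair i a)) (rows-wheel proper hub i a))

    candidates : ∀ i → wt (tab (g i)) (w i) ∈ at (withHub (tab (g hub)) (rowsNear (tab (g hub)))) i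
    candidates hub = here refl
    candidates i0  = near i0 refl
    candidates i1  = near i1 refl
    candidates i2  = near i2 refl
    candidates i3  = near i3 refl
    candidates i4  = near i4 refl

  -- Each pruning is a lower bound for what remains to be paid: one unit for every remaining row
  -- (`few`) and one for every unmarked column (`d₁` to `d₆`).
  ∈-planesWithHub : tab₂ g ∈ planesWithHub (tab (g hub))
  ∈-planesWithHub =
    ∈-map⁺ unweigh {x = found (tab λ i → wt (tab (g i)) (w i)) (partial t₆ m₆)}
      (Search.search⁺ okW step₇ {l = withHub (tab (g hub)) (rowsNear (tab (g hub)))}
        {g = λ i → wt (tab (g i)) (w i)} candidates (rows-wheel proper)
        (step hub (g hub) (few 2 5 e₁ r₅ refl) d₁) (step i0 (g i0) (few 3 4 e₂ r₄ refl) d₂)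
        (step i1 (g i1) (few 4 3 e₃ r₃ refl) d₃) (step i2 (g i2) (few 5 2 e₄ r₂ refl) d₄)
        (step i3 (g i3) (few 6 1 e₅ r₁ refl) d₅)
        (step i4 (g i4) (ℕ.≤-trans (ℕ.≤-reflexive e₆) small) d₆))

-- Symmetries

-- Invariance of sums is a field: the solver proves it for the two generators, and inverses and
-- products inherit it.
record Automorphism : Set where
  field
    to from  : Ix → Ix
    to-from  : ∀ i → to (from i) ≡ i
    from-to  : ∀ i → from (to i) ≡ i
    to-adj   : ∀ i j → adj i j ≡ true → adj (to i) (to j) ≡ true
    from-adj : ∀ i j → adj i j ≡ true → adj (from i) (from j) ≡ true
    Σ-to     : ∀ f → Σ₆ (f ∘ to) ≡ Σ₆ f

open Automorphism

inverse : Automorphism → Automorphism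
inverse σ = record
  { to = from σ ; from = to σ ; to-from = from-to σ ; from-to = to-from σ
  ; to-adj = from-adj σ ; from-adj = to-adj σ
  ; Σ-to = λ f → trans (sym (Σ-to σ (f ∘ from σ))) (Σ₆-cong (λ i → cong f (from-to σ i))) }

infixr 9 _⊙_
_⊙_ : Automorphism → Automorphism → Automorphism
σ ⊙ τ = record
  { to = to σ ∘ to τ ; from = from τ ∘ from σ
  ; to-from = λ i → trans (cong (to σ) (to-from τ (from σ i))) (to-from σ i)
  ; from-to = λ i → trans (cong (from τ) (from-to σ (to τ i))) (from-to τ i)
  ; to-adj = λ i j a → to-adj σ _ _ (to-adj τ i j a)
  ; from-adj = λ i j a → from-adj τ _ _ (from-adj σ i j a)
  ; Σ-to = λ f → trans (Σ-to τ (f ∘ to σ)) (Σ-to σ f) }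

identity : Automorphism
identity = record
  { to = id ; from = id ; to-from = λ _ → refl ; from-to = λ _ → refl
  ; to-adj = λ _ _ → id ; from-adj = λ _ _ → id ; Σ-to = λ _ → refl }

private
  preserves : (Ix → Ix) → Bool
  preserves σ = allIx λ i → allIx λ j → not (adj i j) ∨ adj (σ i) (σ j)

  preserves⇒ : (σ : Ix → Ix) → preserves σ ≡ true → ∀ i j → adj i j ≡ true → adj (σ i) (σ j) ≡ true
  preserves⇒ σ p i j a
    with allIx⇒ (λ j → not (adj i j) ∨ adj (σ i) (σ j))
           (allIx⇒ (λ i → allIx λ j → not (adj i j) ∨ adj (σ i) (σ j)) p i) j
  ... | q rewrite a = q

rotation : Automorphism
rotation = record
  { to = next ; from = prev
  ; to-from = λ { i0 → refl ; i1 → refl ; i2 → refl ; i3 → refl ; i4 → refl ; hub → refl }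
  ; from-to = λ { i0 → refl ; i1 → refl ; i2 → refl ; i3 → refl ; i4 → refl ; hub → refl }
  ; to-adj = preserves⇒ next refl ; from-adj = preserves⇒ prev refl
  ; Σ-to = λ f → solve 6 (λ h a b c d e → h :+ (b :+ (c :+ (d :+ (e :+ a)))) := h :+ (a :+ (b :+ (c :+ (d :+ e)))))
                   refl (f hub) (f i0) (f i1) (f i2) (f i3) (f i4) }
  where
  open +-*-Solver
  next prev : Ix → Ix
  next i0  = i1
  next i1  = i2
  next i2  = i3
  next i3  = i4
  next i4  = i0
  next hub = hub
  prev i0  = i4
  prev i1  = i0
  prev i2  = i1
  prev i3  = i2
  prev i4  = i3
  prev hub = hub

reflection : Automorphism
reflection = record
  { to = flip ; from = flip ; to-from = flip-flip ; from-to = flip-flip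
  ; to-adj = preserves⇒ flip refl ; from-adj = preserves⇒ flip refl
  ; Σ-to = λ f → solve 6 (λ h a b c d e → h :+ (a :+ (e :+ (d :+ (c :+ b)))) := h :+ (a :+ (b :+ (c :+ (d :+ e)))))
                   refl (f hub) (f i0) (f i1) (f i2) (f i3) (f i4) }
  where
  open +-*-Solver
  flip : Ix → Ix
  flip i0  = i0
  flip i1  = i4
  flip i2  = i3
  flip i3  = i2
  flip i4  = i1
  flip hub = hub
  flip-flip : ∀ i → flip (flip i) ≡ i
  flip-flip i0  = refl
  flip-flip i1  = refl
  flip-flip i2  = refl
  flip-flip i3  = refl
  flip-flip i4  = refl
  flip-flip hub = refl

rotations dihedral : List Automorphism
rotations = identity ∷ rotation ∷ rotation ⊙ rotation ∷ inverse (rotation ⊙ rotation) ∷ inverse rotation ∷ []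
dihedral = rotations ++ map (reflection ⊙_) rotations

record Recolouring : Set where
  field
    to from  : Color → Color
    to-from  : ∀ c → to (from c) ≡ c
    from-to  : ∀ c → from (to c) ≡ c
    to-ok    : ∀ a b → okC a b ≡ true → okC (to a) (to b) ≡ true
    from-ok  : ∀ a b → okC a b ≡ true → okC (from a) (from b) ≡ true
    w-to     : ∀ c → wC (to c) ≡ wC c

module R = Recolouring

inverseR : Recolouring → Recolouring
inverseR π = record
  { to = R.from π ; from = R.to π ; to-from = R.from-to π ; from-to = R.to-from π
  ; to-ok = R.from-ok π ; from-ok = R.to-ok π
  ; w-to = λ c → trans (sym (R.w-to π (R.from π c))) (cong wC (R.to-from π c)) }

infixr 9 _⊙R_
_⊙R_ : Recolouring → Recolouring → Recolouring
σ ⊙R τ = record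
  { to = R.to σ ∘ R.to τ ; from = R.from τ ∘ R.from σ
  ; to-from = λ i → trans (cong (R.to σ) (R.to-from τ (R.from σ i))) (R.to-from σ i)
  ; from-to = λ i → trans (cong (R.from τ) (R.from-to σ (R.to τ i))) (R.from-to τ i)
  ; to-ok = λ i j a → R.to-ok σ _ _ (R.to-ok τ i j a)
  ; from-ok = λ i j a → R.from-ok τ _ _ (R.from-ok σ i j a)
  ; w-to = λ c → trans (R.w-to σ (R.to τ c)) (R.w-to τ c) }

identityR : Recolouring
identityR = record
  { to = id ; from = id ; to-from = λ _ → refl ; from-to = λ _ → refl
  ; to-ok = λ _ _ → id ; from-ok = λ _ _ → id ; w-to = λ _ → refl }

involution : (s : Color → Color) → (∀ c → s (s c) ≡ c) →
             (∀ a b → okC a b ≡ true → okC (s a) (s b) ≡ true) → (∀ c → wC (s c) ≡ wC c) → Recolouring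
involution s ss ok w = record
  { to = s ; from = s ; to-from = ss ; from-to = ss ; to-ok = ok ; from-ok = ok ; w-to = w }

-- Compatibility as a statement about equality: equal values must be uncoloured. In this form an
-- involution that fixes `c0` visibly preserves it.
okC-≢ : ∀ a b → (a ≡ b → a ≡ c0) → okC a b ≡ true
okC-≢ c0 b _ = refl
okC-≢ c1 c0 _ = refl
okC-≢ c1 c1 f with () ← f refl
okC-≢ c1 c2 _ = refl
okC-≢ c1 c3 _ = refl
okC-≢ c2 c0 _ = refl
okC-≢ c2 c1 _ = refl
okC-≢ c2 c2 f with () ← f refl
okC-≢ c2 c3 _ = refl
okC-≢ c3 c0 _ = refl
okC-≢ c3 c1 _ = refl
okC-≢ c3 c2 _ = refl
okC-≢ c3 c3 f with () ← f refl

≢-okC : ∀ a b → okC a b ≡ true → a ≡ b → a ≡ c0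
≢-okC c0 .c0 _ refl = refl

swap₁₂ swap₂₃ : Recolouring
swap₁₂ = involution s ss (λ a b ok → okC-≢ (s a) (s b) (λ eq →
    cong s (≢-okC a b ok (trans (sym (ss a)) (trans (cong s eq) (ss b)))))) w
  where
  s : Color → Color
  s c0 = c0
  s c1 = c2
  s c2 = c1
  s c3 = c3
  ss : ∀ c → s (s c) ≡ c
  ss c0 = refl
  ss c1 = refl
  ss c2 = refl
  ss c3 = refl
  w : ∀ c → wC (s c) ≡ wC c
  w c0 = refl
  w c1 = refl
  w c2 = refl
  w c3 = refl
swap₂₃ = involution s ss (λ a b ok → okC-≢ (s a) (s b) (λ eq →
    cong s (≢-okC a b ok (trans (sym (ss a)) (trans (cong s eq) (ss b)))))) w
  where
  s : Color → Color
  s c0 = c0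
  s c1 = c1
  s c2 = c3
  s c3 = c2
  ss : ∀ c → s (s c) ≡ c
  ss c0 = refl
  ss c1 = refl
  ss c2 = refl
  ss c3 = refl
  w : ∀ c → wC (s c) ≡ wC c
  w c0 = refl
  w c1 = refl
  w c2 = refl
  w c3 = refl

recolourings : List Recolouring
recolourings = identityR ∷ swap₁₂ ∷ swap₂₃ ∷ swap₁₂ ⊙R swap₂₃ ∷ swap₂₃ ⊙R swap₁₂ ∷ swap₁₂ ⊙R swap₂₃ ⊙R swap₁₂ ∷ []

-- Symmetries acting on rows, planes and cubes

Proper₃ : (Ix → Ix → Ix → Color) → Set
Proper₃ f = (∀ x → Proper₂ (f x)) × (∀ y z → Proper₁ (λ x → f x y z))

w₃ : (Ix → Ix → Ix → Color) → ℕ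
w₃ f = Σ₆ (w₂ ∘ f)

transform₁ : Recolouring → Automorphism → (Ix → Color) → Ix → Color
transform₁ π γ r z = R.to π (r (to γ z))

transform₂ : Recolouring → Automorphism → Automorphism → (Ix → Ix → Color) → Ix → Ix → Color
transform₂ π β γ g y = transform₁ π γ (g (to β y))

transform₃ : Recolouring → (α β γ : Automorphism) → (Ix → Ix → Ix → Color) → Ix → Ix → Ix → Color
transform₃ π α β γ f x = transform₂ π β γ (f (to α x))

module _ (π : Recolouring) where

  proper₁ : ∀ γ {r} → Proper₁ r → Proper₁ (transform₁ π γ r)
  proper₁ γ p i j a = R.to-ok π _ _ (p _ _ (to-adj γ i j a))

  proper₂ : ∀ β γ {g} → Proper₂ g → Proper₂ (transform₂ π β γ g)
  proper₂ β γ (rows , cols) = (λ y → proper₁ γ (rows (to β y))) , (λ z → proper₁ β (cols (to γ z)))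

  proper₃ : ∀ α β γ {f} → Proper₃ f → Proper₃ (transform₃ π α β γ f)
  proper₃ α β γ (planes , lines) =
    (λ x → proper₂ β γ (planes (to α x))) , (λ y z → proper₁ α (lines (to β y) (to γ z)))

  w₁-transform : ∀ γ r → w₁ (transform₁ π γ r) ≡ w₁ r
  w₁-transform γ r = trans (Σ₆-cong (λ z → R.w-to π (r (to γ z)))) (Σ-to γ (wC ∘ r))

  w₂-transform : ∀ β γ g → w₂ (transform₂ π β γ g) ≡ w₂ g
  w₂-transform β γ g = trans (Σ₆-cong (λ y → w₁-transform γ (g (to β y)))) (Σ-to β (w₁ ∘ g))

  w₃-transform : ∀ α β γ f → w₃ (transform₃ π α β γ f) ≡ w₃ f
  w₃-transform α β γ f = trans (Σ₆-cong (λ x → w₂-transform β γ (f (to α x)))) (Σ-to α (w₂ ∘ f))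

act₁ : Recolouring → Automorphism → Row → Row
act₁ π γ r = tab (transform₁ π γ (at r))

act₂ : Recolouring → Automorphism → Automorphism → Plane → Plane
act₂ π β γ p = tab λ y → act₁ π γ (at p (to β y))

eqR : Row → Row → Bool
eqR = ok6 eqC

eqP : Plane → Plane → Bool
eqP = ok6 eqR

eqR⇒≡ : ∀ {r s} → eqR r s ≡ true → r ≡ s
eqR⇒≡ {r} {s} eq = six-ext λ i → eqC⇒≡ (ok6⁻ eqC {r} {s} eq i)

eqP⇒≡ : ∀ {p q} → eqP p q ≡ true → p ≡ q
eqP⇒≡ {p} {q} eq = six-ext λ i → eqR⇒≡ (ok6⁻ eqR {p} {q} eq i)

-- Normal forms under the symmetries

module Canonical (πs : List Recolouring) (γs : List Automorphism) (cs : List Row) where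

  image? : Row → Row → Recolouring → Automorphism → Bool
  image? r c π γ = eqR r (act₁ π γ c)

  canonical? : Row → Bool
  canonical? r = any (λ c → any (λ π → any (image? r c π) γs) πs) cs

  record Image (r : Row) : Set where
    constructor image
    field
      {row}         : Row
      {recolouring} : Recolouring
      {symmetry}    : Automorphism
      row∈          : row ∈ cs
      recolouring∈  : recolouring ∈ πs
      symmetry∈     : symmetry ∈ γs
      equal         : r ≡ act₁ recolouring symmetry row

  canonical⇒ : ∀ r → canonical? r ≡ true → Image r
  canonical⇒ r e with any⇒ (λ c → any (λ π → any (image? r c π) γs) πs) cs e
  ... | c , c∈ , e with any⇒ (λ π → any (image? r c π) γs) πs e
  ... | π , π∈ , e with any⇒ (image? r c π) γs e
  ... | γ , γ∈ , e = image c∈ π∈ γ∈ (eqR⇒≡ e)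

module Representation (πs : List Recolouring) (γs : List Automorphism) (ps : List Plane) where

  represents? : Plane → Recolouring → Automorphism → Automorphism → Bool
  represents? p π γ β = any (eqP (act₂ π β γ p)) ps

  represented? : Plane → Bool
  represented? p = any (λ π → any (λ γ → any (represents? p π γ) γs) γs) πs

  represented⇒ : ∀ p → represented? p ≡ true → ∃ λ π → ∃ λ β → ∃ λ γ → act₂ π β γ p ∈ ps
  represented⇒ p e with any⇒ (λ π → any (λ γ → any (represents? p π γ) γs) γs) πs e
  ... | π , _ , e with any⇒ (λ γ → any (represents? p π γ) γs) γs e
  ... | γ , _ , e with any⇒ (represents? p π γ) γs e
  ... | β , _ , e with any⇒ (eqP (act₂ π β γ p)) ps e
  ... | r , r∈ , e = π , β , γ , subst (_∈ ps) (sym (eqP⇒≡ e)) r∈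

module Images (πs : List Recolouring) (γs : List Automorphism) where

  images : List Plane → List Plane
  images ps = concatMap (λ γ → concatMap (λ π → map (act₂ π identity γ) ps) πs) γs

  ∈-images : ∀ {π γ ps p} → π ∈ πs → γ ∈ γs → p ∈ ps → act₂ π identity γ p ∈ images ps
  ∈-images {π} {γ} {ps} π∈ γ∈ p∈ =
    ∈-concatMap⁺ (λ γ → concatMap (λ π → map (act₂ π identity γ) ps) πs) (lose γ∈
      (∈-concatMap⁺ (λ π → map (act₂ π identity γ) ps) (lose π∈ (∈-map⁺ (act₂ π identity γ) p∈))))

-- The rows of weight at most 2 up to rotation and recolouring: two of weight 1, then three of
-- weight 2 with coloured hub and four with uncoloured hub.
canonicalRows : List Row
canonicalRows =
    six c0 c1 c2 c1 c2 c3 ∷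
    six c1 c2 c1 c2 c3 c0 ∷
    six c0 c0 c1 c2 c1 c3 ∷
    six c0 c1 c0 c1 c2 c3 ∷
    six c0 c1 c0 c2 c1 c3 ∷
    six c0 c1 c2 c1 c2 c0 ∷
    six c0 c1 c2 c1 c3 c0 ∷
    six c0 c1 c2 c3 c1 c0 ∷
    six c0 c1 c2 c3 c2 c0 ∷ []

open Canonical recolourings rotations canonicalRows
open Images recolourings rotations

all-canonical : all (canonical? ∘ item) lowRows ≡ true
all-canonical = refl

wPlane : Plane → ℕ
wPlane p = total (map6 wRow p)

-- Here and below the lists computed by the search are parameters, because type checking would otherwise unfold them.
module HubPlanes {pss : List (List Plane)} (∈-pss : ∀ {c} → c ∈ canonicalRows → planesWithHub c ∈ pss) where

  -- The symmetry acts on the colours and on the positions inside a row; no row is moved to another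
  -- place. Undoing it therefore makes the hub row canonical and keeps it the hub row.
  record Normal (g : Ix → Ix → Color) (π : Recolouring) (γ : Automorphism) : Set where
    form : Ix → Ix → Color
    form = transform₂ (inverseR π) identity (inverse γ) g
    field
      {planes} : List Plane
      planes∈  : planes ∈ pss
      form∈    : tab₂ form ∈ planes
      image∈   : tab₂ g ∈ images planes

  module _ {g : Ix → Ix → Color} (proper : Proper₂ g) (small : w₂ g ≤ 7) where

    private
      hubRow : Row
      hubRow = tab (g hub)

      canonical : canonical? hubRow ≡ true
      canonical = all⇒ (canonical? ∘ item) {xs = lowRows} {x = wt hubRow (w₁ (g hub))}
        all-canonical (∈-rows {b = 2} (proj₁ proper hub) (w₁≤2 proper small hub))

      normal : Image hubRow → ∃ λ π → ∃ λ γ → Normal g π γ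
      normal (image {c} {π} {γ} c∈ π∈ γ∈ eq) = π , γ , record
        { planes∈ = ∈-pss c∈
        ; form∈ = q∈
        ; image∈ = subst (_∈ images (planesWithHub c)) (sym g≡) (∈-images π∈ γ∈ q∈) }
        where
        q : Ix → Ix → Color
        q = transform₂ (inverseR π) identity (inverse γ) g

        g-hub : ∀ z → g hub z ≡ R.to π (at c (to γ z))
        g-hub z = trans (sym (at-tab (g hub) z)) (trans (cong (λ r → at r z) eq) (at-tab (transform₁ π γ (at c)) z))

        hub≡ : tab (q hub) ≡ c
        hub≡ = six-ext λ z → trans (at-tab (q hub) z)
          (trans (cong (R.from π) (g-hub (from γ z)))
          (trans (R.from-to π _) (cong (at c) (to-from γ z))))

        q∈ : tab₂ q ∈ planesWithHub c
        q∈ = subst (λ r → tab₂ q ∈ planesWithHub r) hub≡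
          (∈-planesWithHub (proper₂ (inverseR π) identity (inverse γ) proper)
            (ℕ.≤-trans (ℕ.≤-reflexive (w₂-transform (inverseR π) identity (inverse γ) g)) small))

        g≡ : tab₂ g ≡ act₂ π identity γ (tab₂ q)
        g≡ = tab-cong λ y → tab-cong λ z → sym
          (trans (cong (R.to π) (at₂-tab₂ q y (to γ z)))
          (trans (R.to-from π _) (cong (g y) (from-to γ z))))

    normalise : ∃ λ π → ∃ λ γ → Normal g π γ
    normalise = normal (canonical⇒ hubRow canonical)

    ∈-all-images : tab₂ g ∈ concatMap images pss
    ∈-all-images = ∈-concatMap⁺ images (lose (Normal.planes∈ n) (Normal.image∈ n))
      where n = proj₂ (proj₂ normalise)

  -- A plane of weight below 7 would be light enough to be enumerated, up to a symmetry that
  -- preserves weight, and `heavy` says that every enumerated plane weighs at least 7.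
  w₂≥7 : all (all (λ p → 7 ≤ᵇ wPlane p)) pss ≡ true → ∀ {g} → Proper₂ g → 7 ≤ w₂ g
  w₂≥7 heavy {g} p = [ (λ { (s≤s small) → light (proj₂ (proj₂ (normalise p small))) }) , ℕ.<⇒≤ ]′
      (ℕ.<-≤-connex (w₂ g) 8)
    where
    light : ∀ {π γ} → Normal g π γ → 7 ≤ w₂ g
    light {π} {γ} n = subst (7 ≤_) (w₂-transform (inverseR π) identity (inverse γ) g)
      (ℕ.≤ᵇ⇒≤ 7 (w₂ form) (Equivalence.from T-≡
        (all⇒ (λ p → 7 ≤ᵇ wPlane p) {xs = planes} {x = tab₂ form}
          (all⇒ (all (λ p → 7 ≤ᵇ wPlane p)) {xs = pss} {x = planes} heavy planes∈) form∈)))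
      where open Normal n

  module _ (πs : List Recolouring) (γs : List Automorphism) (ps : List Plane) where
    open Representation πs γs ps

    record Represented (f : Ix → Ix → Ix → Color) (x : Ix) : Set where
      field
        {cube}  : Ix → Ix → Ix → Color
        proper  : Proper₃ cube
        weight₂ : ∀ x → w₂ (cube x) ≡ w₂ (f x)
        cube∈   : tab₂ (cube x) ∈ ps

    -- The symmetry found for the single layer `x` is applied to the whole cube, with the identity
    -- in the first direction. Hence every layer keeps its place and its weight while layer `x`
    -- becomes a member of `ps`.
    represent : all (all represented?) pss ≡ true → ∀ {f} → Proper₃ f → ∀ x → w₂ (f x) ≤ 7 → Represented f x
    represent covered {f} p x small = choose (proj₂ (proj₂ (normalise (proj₁ p x) small)))
      where
      choose : ∀ {π γ} → Normal (f x) π γ → Represented f x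
      choose {π} {γ} n = build (represented⇒ (tab₂ form)
          (all⇒ represented? {xs = planes} {x = tab₂ form}
            (all⇒ (all represented?) {xs = pss} {x = planes} covered planes∈) form∈))
        where
        open Normal n

        f₁ : Ix → Ix → Ix → Color
        f₁ = transform₃ (inverseR π) identity identity (inverse γ) f

        build : (∃ λ π′ → ∃ λ β → ∃ λ γ′ → act₂ π′ β γ′ (tab₂ form) ∈ ps) → Represented f x
        build (π′ , β , γ′ , r∈) = record
          { cube = transform₃ π′ identity β γ′ f₁
          ; proper = proper₃ π′ identity β γ′ (proper₃ (inverseR π) identity identity (inverse γ) p)
          ; weight₂ = λ x → trans (w₂-transform π′ β γ′ (f₁ x))
              (w₂-transform (inverseR π) identity (inverse γ) (f x))
          ; cube∈ = subst (_∈ ps) (tab-cong λ y → tab-cong λ z →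
              cong (R.to π′) (at₂-tab₂ form (to β y) (to γ′ z))) r∈ }

-- A certificate: `verify` tests that each enumerated plane can be carried onto one of these by a
-- recolouring and a dihedral symmetry in each direction.
representatives : List Plane
representatives =
    six (six c0 c2 c3 c2 c3 c1)
        (six c1 c3 c1 c3 c0 c2)
        (six c3 c2 c3 c2 c1 c0)
        (six c2 c3 c2 c0 c3 c1)
        (six c3 c0 c1 c3 c1 c2)
        (six c0 c1 c0 c1 c2 c3) ∷
    six (six c1 c2 c3 c2 c3 c0)
        (six c2 c3 c2 c3 c0 c1)
        (six c3 c2 c1 c2 c1 c0)
        (six c2 c3 c2 c0 c3 c1)
        (six c3 c0 c1 c3 c1 c2)
        (six c0 c1 c0 c1 c2 c3) ∷
    six (six c1 c2 c3 c2 c3 c0)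
        (six c2 c3 c2 c3 c0 c1)
        (six c3 c2 c3 c2 c1 c0)
        (six c2 c3 c2 c0 c3 c1)
        (six c3 c0 c1 c3 c1 c2)
        (six c0 c1 c0 c1 c2 c3) ∷
    six (six c1 c3 c1 c3 c0 c2)
        (six c2 c0 c3 c2 c3 c1)
        (six c3 c0 c1 c3 c1 c2)
        (six c2 c3 c2 c0 c3 c1)
        (six c3 c2 c3 c2 c1 c0)
        (six c0 c1 c0 c1 c2 c3) ∷
    six (six c1 c3 c1 c3 c0 c2)
        (six c2 c0 c3 c2 c3 c1)
        (six c3 c2 c1 c3 c1 c0)
        (six c2 c3 c2 c0 c3 c1)
        (six c3 c2 c3 c2 c1 c0)
        (six c0 c1 c0 c1 c2 c3) ∷
    six (six c0 c2 c3 c2 c3 c1)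
        (six c1 c3 c1 c3 c0 c2)
        (six c3 c2 c3 c0 c1 c0)
        (six c2 c3 c0 c2 c3 c1)
        (six c3 c0 c1 c3 c1 c2)
        (six c0 c1 c2 c1 c2 c3) ∷
    six (six c0 c2 c3 c2 c3 c1)
        (six c1 c3 c1 c3 c0 c2)
        (six c3 c2 c3 c2 c1 c0)
        (six c2 c3 c0 c0 c3 c1)
        (six c3 c0 c1 c3 c1 c2)
        (six c0 c1 c2 c1 c2 c3) ∷
    six (six c1 c3 c0 c0 c3 c2)
        (six c3 c2 c1 c3 c1 c0)
        (six c2 c0 c3 c2 c3 c1)
        (six c1 c3 c1 c3 c0 c2)
        (six c3 c2 c3 c2 c0 c1)
        (six c0 c1 c2 c1 c2 c3) ∷
    six (six c1 c3 c0 c0 c3 c2)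
        (six c3 c2 c1 c3 c1 c0)
        (six c2 c0 c3 c2 c3 c1)
        (six c1 c3 c1 c3 c0 c2)
        (six c3 c2 c3 c2 c1 c0)
        (six c0 c1 c2 c1 c2 c3) ∷
    six (six c1 c3 c1 c0 c3 c2)
        (six c3 c2 c0 c3 c1 c0)
        (six c2 c0 c3 c2 c3 c1)
        (six c1 c3 c1 c3 c0 c2)
        (six c3 c2 c3 c2 c0 c1)
        (six c0 c1 c2 c1 c2 c3) ∷
    six (six c1 c3 c1 c0 c3 c2)
        (six c3 c2 c0 c3 c1 c0)
        (six c2 c0 c3 c2 c3 c1)
        (six c1 c3 c1 c3 c0 c2)
        (six c3 c2 c3 c2 c1 c0)
        (six c0 c1 c2 c1 c2 c3) ∷ []

-- Refutation of a partially known colouring of W₅ □ W₅ □ W₅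

code : Row → ℕ
code (six a b c d e h) = digit a + 4 * (digit b + 4 * (digit c + 4 * (digit d + 4 * (digit e + 4 * digit h))))
  where
  digit : Color → ℕ
  digit c0 = 0
  digit c1 = 1
  digit c2 = 2
  digit c3 = 3

columns : {A : Set} → Six (Six A) → Six (Six A)
columns p = tab λ z → map6 (λ r → at r z) p

-- Only equality of rows is ever tested here, and on the codes that is a single primitive evaluation step.
data Indexed : Set where
  indexed : Plane → Six ℕ → Six ℕ → Indexed

index : Plane → Indexed
index p = indexed p (map6 code p) (map6 code (columns p))

plane : Indexed → Plane
plane (indexed p _ _) = p

rowCodes colCodes : Indexed → Six ℕ
rowCodes (indexed _ r _) = r
colCodes (indexed _ _ c) = c

rowCodes-index : ∀ g i → at (rowCodes (index (tab₂ g))) i ≡ code (tab (g i))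
rowCodes-index g i = trans (at-map6 code (tab₂ g) i) (cong code (at-tab (tab ∘ g) i))

colCodes-index : ∀ g i → at (colCodes (index (tab₂ g))) i ≡ code (tab (λ y → g y i))
colCodes-index g i = rowCodes-index (λ z y → g y z) i

-- `big` records nothing about a layer. In the second and third directions it stands for a layer of
-- weight above 7; in the first it stands for each of the four layers outside the chosen pair,
-- whatever their weight.
data Layer : Set where
  big   : Layer
  layer : Indexed → Layer

okL : Layer → Layer → Bool
okL (layer p) (layer q) = okP (plane p) (plane q)
okL _ _ = true

data Describes : Layer → (Ix → Ix → Color) → Set where
  vague : ∀ {g} → Describes big g
  exact : ∀ {g} → Describes (layer (index (tab₂ g))) g

-- One flag for each of `c1`, `c2`, `c3`, raised when a neighbour is known to have that colour.
data Blocked : Set where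
  blocked : Bool → Bool → Bool → Blocked

allowed : Color → Blocked → Bool
allowed c0 _ = true
allowed c1 (blocked x y z) = not x
allowed c2 (blocked x y z) = not y
allowed c3 (blocked x y z) = not z

block : Color → Blocked → Blocked
block c0 b = b
block c1 (blocked x y z) = blocked true y z
block c2 (blocked x y z) = blocked x true z
block c3 (blocked x y z) = blocked x y true

none : Blocked
none = blocked false false false

allowed-none : ∀ v → allowed v none ≡ true
allowed-none c0 = refl
allowed-none c1 = refl
allowed-none c2 = refl
allowed-none c3 = refl

allowed-block : ∀ c v b → okC c v ≡ true → allowed v b ≡ true → allowed v (block c b) ≡ true
allowed-block c0 v b _ p = p
allowed-block c1 c0 _ _ _ = refl
allowed-block c2 c0 _ _ _ = refl
allowed-block c3 c0 _ _ _ = refl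
allowed-block c1 c2 (blocked _ _ _) _ p = p
allowed-block c1 c3 (blocked _ _ _) _ p = p
allowed-block c2 c1 (blocked _ _ _) _ p = p
allowed-block c2 c3 (blocked _ _ _) _ p = p
allowed-block c3 c1 (blocked _ _ _) _ p = p
allowed-block c3 c2 (blocked _ _ _) _ p = p

data Cell : Set where
  known : Color → Cell
  open′ : Blocked → Cell

data Fits : Cell → Color → Set where
  known : ∀ {v} → Fits (known v) v
  open′ : ∀ {v b} → allowed v b ≡ true → Fits (open′ b) v

-- A vertex that sees all three colours has to stay uncoloured.
forced : Blocked → ℕ
forced (blocked true true true) = 1
forced _ = 0

lbC : Cell → ℕ
lbC (known c) = wC c
lbC (open′ b) = forced b

lbC≤wC : ∀ {c v} → Fits c v → lbC c ≤ wC v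
lbC≤wC known = ℕ.≤-refl
lbC≤wC (open′ {c0} {blocked true  true  true } _) = ℕ.≤-refl
lbC≤wC (open′ {c0} {blocked true  true  false} _) = z≤n
lbC≤wC (open′ {c0} {blocked true  false _} _) = z≤n
lbC≤wC (open′ {c0} {blocked false _ _} _) = z≤n
lbC≤wC (open′ {c1} {blocked false _ _} _) = z≤n
lbC≤wC (open′ {c2} {blocked true  false _} _) = z≤n
lbC≤wC (open′ {c2} {blocked false false _} _) = z≤n
lbC≤wC (open′ {c3} {blocked true  true  false} _) = z≤n
lbC≤wC (open′ {c3} {blocked true  false false} _) = z≤n
lbC≤wC (open′ {c3} {blocked false _ false} _) = z≤n

unless : Bool → Color → List (Weighted Color) → List (Weighted Color)
unless true  _ l = l
unless false c l = wt c 0 ∷ l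

fills : Cell → List (Weighted Color)
fills (known c) = wt c (wC c) ∷ []
fills (open′ (blocked x y z)) = wt c0 1 ∷ unless x c1 (unless y c2 (unless z c3 []))

∈-unless : ∀ x {c l v} → v ∈ l → v ∈ unless x c l
∈-unless true  p = p
∈-unless false p = there p

∈-fills : ∀ {c v} → Fits c v → wt v (wC v) ∈ fills c
∈-fills known = here refl
∈-fills (open′ {c0} {blocked _ _ _} _) = here refl
∈-fills (open′ {c1} {blocked false _ _} _) = there (here refl)
∈-fills (open′ {c2} {blocked x false _} _) = there (∈-unless x (here refl))
∈-fills (open′ {c3} {blocked x y false} _) = there (∈-unless x (∈-unless y (here refl)))

rowBlocks : Row → Six Blocked
rowBlocks (six a b c d e h) =
  six (near b e) (near a c) (near b d) (near c e) (near d a)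
      (block a (block b (block c (block d (block e none)))))
  where
  near : Color → Color → Blocked
  near x y = block x (block y (block h none))

allowed-rowBlocks : ∀ r z {v} → (∀ z′ → adj z′ z ≡ true → okC (at r z′) v ≡ true) →
                    allowed v (at (rowBlocks r) z) ≡ true
allowed-rowBlocks (six a b c d e h) z {v} ok = go z ok
  where
  three : ∀ x y → okC x v ≡ true → okC y v ≡ true → okC h v ≡ true → allowed v (block x (block y (block h none))) ≡ true
  three x y p q s = allowed-block x v _ p (allowed-block y v _ q (allowed-block h v _ s (allowed-none v)))
  go : ∀ z → (∀ z′ → adj z′ z ≡ true → okC (at (six a b c d e h) z′) v ≡ true) →
       allowed v (at (rowBlocks (six a b c d e h)) z) ≡ true
  go i0 ok = three b e (ok i1 refl) (ok i4 refl) (ok hub refl)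
  go i1 ok = three a c (ok i0 refl) (ok i2 refl) (ok hub refl)
  go i2 ok = three b d (ok i1 refl) (ok i3 refl) (ok hub refl)
  go i3 ok = three c e (ok i2 refl) (ok i4 refl) (ok hub refl)
  go i4 ok = three d a (ok i3 refl) (ok i0 refl) (ok hub refl)
  go hub ok = allowed-block a v _ (ok i0 refl) (allowed-block b v _ (ok i1 refl)
    (allowed-block c v _ (ok i2 refl) (allowed-block d v _ (ok i3 refl)
    (allowed-block e v _ (ok i4 refl) (allowed-none v)))))

blockRow : Row → Six Blocked → Six Blocked
blockRow = zip6 block

colBlocks : Ix → Plane → Six Blocked → Six Blocked
colBlocks i0  (six a b c d e h) s = blockRow b (blockRow e (blockRow h s))
colBlocks i1  (six a b c d e h) s = blockRow a (blockRow c (blockRow h s))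
colBlocks i2  (six a b c d e h) s = blockRow b (blockRow d (blockRow h s))
colBlocks i3  (six a b c d e h) s = blockRow c (blockRow e (blockRow h s))
colBlocks i4  (six a b c d e h) s = blockRow d (blockRow a (blockRow h s))
colBlocks hub (six a b c d e h) s = blockRow a (blockRow b (blockRow c (blockRow d (blockRow e s))))

allowed-blockRow : ∀ r s z {v} → okC (at r z) v ≡ true → allowed v (at s z) ≡ true →
                   allowed v (at (blockRow r s) z) ≡ true
allowed-blockRow r s z {v} ok p =
  subst (λ b → allowed v b ≡ true) (sym (at-zip6 block r s z)) (allowed-block (at r z) v (at s z) ok p)

allowed-colBlocks : ∀ y g s z {v} → (∀ y′ → adj y′ y ≡ true → okC (at (at g y′) z) v ≡ true) →
                    allowed v (at s z) ≡ true → allowed v (at (colBlocks y g s) z) ≡ true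
allowed-colBlocks i0 (six a b c d e h) s z ok p =
  allowed-blockRow b _ z (ok i1 refl) (allowed-blockRow e _ z (ok i4 refl) (allowed-blockRow h s z (ok hub refl) p))
allowed-colBlocks i1 (six a b c d e h) s z ok p =
  allowed-blockRow a _ z (ok i0 refl) (allowed-blockRow c _ z (ok i2 refl) (allowed-blockRow h s z (ok hub refl) p))
allowed-colBlocks i2 (six a b c d e h) s z ok p =
  allowed-blockRow b _ z (ok i1 refl) (allowed-blockRow d _ z (ok i3 refl) (allowed-blockRow h s z (ok hub refl) p))
allowed-colBlocks i3 (six a b c d e h) s z ok p =
  allowed-blockRow c _ z (ok i2 refl) (allowed-blockRow e _ z (ok i4 refl) (allowed-blockRow h s z (ok hub refl) p))
allowed-colBlocks i4 (six a b c d e h) s z ok p =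
  allowed-blockRow d _ z (ok i3 refl) (allowed-blockRow a _ z (ok i0 refl) (allowed-blockRow h s z (ok hub refl) p))
allowed-colBlocks hub (six a b c d e h) s z ok p =
  allowed-blockRow a _ z (ok i0 refl) (allowed-blockRow b _ z (ok i1 refl) (allowed-blockRow c _ z (ok i2 refl)
    (allowed-blockRow d _ z (ok i3 refl) (allowed-blockRow e s z (ok i4 refl) p))))

-- Vertices that the known layers do not determine are read as uncoloured, so that they block no colour.
cellSeen : Ix → Ix → Layer → Color
cellSeen a y big       = c0
cellSeen a y (layer Z) = at (at (plane Z) a) y

rowSeen : Ix → Six Layer → Ix → Layer → Row
rowSeen a zs y big       = map6 (cellSeen a y) zs
rowSeen a zs y (layer Y) = at (plane Y) a

cell : Color → Layer → Blocked → Cell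
cell c big       b = open′ b
cell c (layer _) b = known c

openRow : Row → Six Layer → Six Blocked → Six Cell
openRow r zs bs = zip6 (λ f b → f b) (zip6 cell r zs) bs

rowCells : Plane → Six Layer → Ix → Layer → Six Cell
rowCells g zs y (layer _) = map6 known (at g y)
rowCells g zs y big       = go (at g y)
  where
  go : Row → Six Cell
  go r = openRow r zs (colBlocks y g (rowBlocks r))

-- Colours are blocked only by neighbours inside the same layer `a`. Adjacency between layers of the
-- first direction enters later, through `okP` in `refuted`.
cells : Six Layer → Six Layer → Ix → Layer → Six (Six Cell)
cells ys zs a (layer X) = map6 (map6 known) (plane X)
cells ys zs a big       = go (zip6 (rowSeen a zs) ix ys)
  where
  go : Plane → Six (Six Cell)
  go g = zip6 (rowCells g zs) ix ys

atLeast1 : ℕ → ℕ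
atLeast1 zero    = 1
atLeast1 (suc n) = suc n

lines : Six (Six ℕ) → ℕ
lines m = total (map6 (atLeast1 ∘ total) m)

max : ℕ → ℕ → ℕ
max m n = if m <ᵇ n then n else m

lbR : Six Cell → ℕ
lbR r = atLeast1 (total (map6 lbC r))

-- The rows and the columns each partition the layer into six copies of W₅, and a copy counts at
-- least 1 even where nothing is forced. The better of the two partitions is taken.
lbP : Six (Six Cell) → ℕ
lbP p = go (map6 (map6 lbC) p)
  where
  go : Six (Six ℕ) → ℕ
  go m = max (lines m) (lines (columns m))

rowFills : Six Cell → ℕ → List (Weighted Row)
rowFills r = bounded okC (map6 lbC r) (map6 (λ c _ → fills c) r)

planeFills : Six (Six Cell) → ℕ → List (Weighted Plane)
planeFills p = bounded okR (map6 lbR p) (map6 rowFills p)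

-- An empty list means that no completion of the layer fits the budget. The value 46 then lifts the
-- sum of the bounds above 45, which ends the case.
lightest : {A : Set} → List (Weighted A) → ℕ
lightest []       = 46
lightest (x ∷ xs) = weight x ⊓ lightest xs

eqIx : Ix → Ix → Bool
eqIx i0  i0  = true
eqIx i1  i1  = true
eqIx i2  i2  = true
eqIx i3  i3  = true
eqIx i4  i4  = true
eqIx hub hub = true
eqIx _   _   = false

update : {A : Set} → Ix → A → Six A → Six A
update i a s = tab λ j → if eqIx i j then a else at s j

-- Replaces the lower bound for layer i by the exact minimum over its completions, within the total of 45.
improve : Six (Six (Six Cell)) → Ix → Layer → Six ℕ → Six ℕ
improve c i (layer _) m = m
improve c i big       m = go (total m)
  where
  go : ℕ → Six ℕ
  go t = if t ≤ᵇ 45 then update i (lightest (planeFills (at c i) (at m i + (45 ∸ t)))) m else m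

improveAll : Six (Six (Six Cell)) → Six Layer → Six ℕ → Six ℕ
improveAll c (six X₀ X₁ X₂ X₃ X₄ Xₕ) m =
  improve c i4 X₄ (improve c i3 X₃ (improve c i2 X₂ (improve c i1 X₁ (improve c i0 X₀ (improve c hub Xₕ m)))))

-- If the improved bounds sum to more than 45, `bounded` returns the empty list at once; otherwise
-- the completions are really enumerated.
refuted : Six Layer → Six Layer → Six Layer → Bool
refuted xs ys zs = go (zip6 (cells ys zs) ix xs)
  where
  go : Six (Six (Six Cell)) → Bool
  go c = null (bounded okP (improveAll c xs (map6 lbP c)) (map6 planeFills c) 45)

-- Soundness of the refutation

okC-sym : ∀ a b → okC a b ≡ true → okC b a ≡ true
okC-sym c0 c0 p = refl
okC-sym c0 c1 p = refl
okC-sym c0 c2 p = refl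
okC-sym c0 c3 p = refl
okC-sym c1 c0 p = refl
okC-sym c1 c2 p = refl
okC-sym c1 c3 p = refl
okC-sym c2 c0 p = refl
okC-sym c2 c1 p = refl
okC-sym c2 c3 p = refl
okC-sym c3 c0 p = refl
okC-sym c3 c1 p = refl
okC-sym c3 c2 p = refl

planes-wheel : ∀ {f} → Proper₃ f → Wheel okP (tab₂ ∘ f)
planes-wheel {f} (_ , lines) i j a = tab₂-ok (f i) (f j) λ y z → lines y z i j a

atLeast1-≤ : ∀ {m n} → m ≤ n → 1 ≤ n → atLeast1 m ≤ n
atLeast1-≤ {zero}  _ p = p
atLeast1-≤ {suc m} p _ = p

max-≤ : ∀ {m n o} → m ≤ o → n ≤ o → max m n ≤ o
max-≤ {m} {n} p q with m <ᵇ n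
... | true  = q
... | false = p

at₂-map6 : {A B : Set} (f : A → B) (p : Six (Six A)) → ∀ y z → at (at (map6 (map6 f) p) y) z ≡ f (at (at p y) z)
at₂-map6 f p y z = trans (cong (λ r → at r z) (at-map6 (map6 f) p y)) (at-map6 f (at p y) z)

total≡ : ∀ s → total s ≡ Σ₆ (at s)
total≡ s = cong total (sym (tab-at s))

lines-≤ : ∀ m {g} → (∀ y z → at (at m y) z ≤ wC (g y z)) → (∀ y → Proper₁ (g y)) → lines m ≤ w₂ g
lines-≤ m {g} le p = ℕ.≤-trans (ℕ.≤-reflexive (total≡ (map6 (atLeast1 ∘ total) m))) (Σ₆-mono λ y →
  ℕ.≤-trans (ℕ.≤-reflexive (at-map6 (atLeast1 ∘ total) m y))
    (atLeast1-≤ (ℕ.≤-trans (ℕ.≤-reflexive (total≡ (at m y))) (Σ₆-mono (le y))) (1≤w₁ (p y))))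

at₂-columns : {A : Set} (m : Six (Six A)) → ∀ y z → at (at (columns m) z) y ≡ at (at m y) z
at₂-columns m y z = trans (cong (λ r → at r y) (at-tab (λ z → map6 (λ r → at r z) m) z)) (at-map6 (λ r → at r z) m y)

w₂-transpose : ∀ g → w₂ (λ z y → g y z) ≡ w₂ g
w₂-transpose g = Σ₆-comm (λ z y → wC (g y z))

module _ {r : Six Cell} {v : Ix → Color} (fits : ∀ z → Fits (at r z) (v z)) (p : Proper₁ v) where

  lbR≤w₁ : lbR r ≤ w₁ v
  lbR≤w₁ = atLeast1-≤ (ℕ.≤-trans (ℕ.≤-reflexive (total≡ (map6 lbC r)))
    (Σ₆-mono λ z → ℕ.≤-trans (ℕ.≤-reflexive (at-map6 lbC r z)) (lbC≤wC (fits z)))) (1≤w₁ p)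

  ∈-rowFills : ∀ {b} → w₁ v ≤ b → wt (tab v) (w₁ v) ∈ rowFills r b
  ∈-rowFills = bounded⁺ okC (map6 lbC r) (map6 (λ c _ → fills c) r) {g = v} {w = wC ∘ v}
    (λ z → subst (_≤ wC (v z)) (sym (at-map6 lbC r z)) (lbC≤wC (fits z)))
    (λ z {b} _ → subst (λ l → wt (v z) (wC (v z)) ∈ l b) (sym (at-map6 (λ c _ → fills c) r z)) (∈-fills (fits z)))
    p

module _ {c : Six (Six Cell)} {g : Ix → Ix → Color} (fits : ∀ y z → Fits (at (at c y) z) (g y z)) (p : Proper₂ g) where

  private
    cell-≤ : ∀ y z → at (at (map6 (map6 lbC) c) y) z ≤ wC (g y z)
    cell-≤ y z = ℕ.≤-trans (ℕ.≤-reflexive (at₂-map6 lbC c y z)) (lbC≤wC (fits y z))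

  lbP≤w₂ : lbP c ≤ w₂ g
  lbP≤w₂ = max-≤ (lines-≤ (map6 (map6 lbC) c) cell-≤ (proj₁ p))
    (ℕ.≤-trans (lines-≤ (columns (map6 (map6 lbC) c)) {λ z y → g y z}
      (λ z y → ℕ.≤-trans (ℕ.≤-reflexive (at₂-columns (map6 (map6 lbC) c) y z)) (cell-≤ y z)) (proj₂ p))
      (ℕ.≤-reflexive (w₂-transpose g)))

  ∈-planeFills : ∀ {b} → w₂ g ≤ b → wt (tab₂ g) (w₂ g) ∈ planeFills c b
  ∈-planeFills = bounded⁺ okR (map6 lbR c) (map6 rowFills c) {g = tab ∘ g} {w = w₁ ∘ g}
    (λ y → subst (_≤ w₁ (g y)) (sym (at-map6 lbR c y)) (lbR≤w₁ {r = at c y} (fits y) (proj₁ p y)))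
    (λ y {b} le → subst (λ l → wt (tab (g y)) (w₁ (g y)) ∈ l b) (sym (at-map6 rowFills c y))
      (∈-rowFills {r = at c y} (fits y) (proj₁ p y) le))
    (rows-wheel p)

lightest-≤ : {A : Set} {x : Weighted A} {l : List (Weighted A)} → x ∈ l → lightest l ≤ weight x
lightest-≤ {x = x} {_ ∷ l} (here refl) = ℕ.m⊓n≤m (weight x) (lightest l)
lightest-≤ {l = y ∷ l} (there x∈) = ℕ.≤-trans (ℕ.m⊓n≤n (weight y) (lightest l)) (lightest-≤ x∈)

eqIx⇒≡ : ∀ i j → eqIx i j ≡ true → i ≡ j
eqIx⇒≡ i0  i0  _ = refl
eqIx⇒≡ i1  i1  _ = refl
eqIx⇒≡ i2  i2  _ = refl
eqIx⇒≡ i3  i3  _ = refl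
eqIx⇒≡ i4  i4  _ = refl
eqIx⇒≡ hub hub _ = refl

update-≤ : ∀ i {v m} {w : Ix → ℕ} → v ≤ w i → (∀ j → at m j ≤ w j) → ∀ j → at (update i v m) j ≤ w j
update-≤ i {v} {m} {w} v≤ m≤ j = subst (_≤ w j) (sym (at-tab (λ j → if eqIx i j then v else at m j) j)) (go (eqIx i j) refl)
  where
  go : ∀ b → eqIx i j ≡ b → (if b then v else at m j) ≤ w j
  go true  eq = subst (λ k → v ≤ w k) (eqIx⇒≡ i j eq) v≤
  go false _  = m≤ j

module _ {f : Ix → Ix → Ix → Color} (p : Proper₃ f) {xs ys zs : Six Layer}
         (dx : ∀ x → Describes (at xs x) (f x))
         (dy : ∀ y → Describes (at ys y) (λ x z → f x y z))
         (dz : ∀ z → Describes (at zs z) (λ x y → f x y z)) where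

  private
    cellSeen-≡ : ∀ a y z {L} → Describes L (λ x y → f x y z) → cellSeen a y L ≡ c0 ⊎ cellSeen a y L ≡ f a y z
    cellSeen-≡ a y z vague = inj₁ refl
    cellSeen-≡ a y z exact = inj₂ (at₂-tab₂ (λ x y → f x y z) a y)

    rowSeen-≡ : ∀ a y z {L} → Describes L (λ x z → f x y z) →
                at (rowSeen a zs y L) z ≡ c0 ⊎ at (rowSeen a zs y L) z ≡ f a y z
    rowSeen-≡ a y z vague = subst (λ c → c ≡ c0 ⊎ c ≡ f a y z) (sym (at-map6 (cellSeen a y) zs z)) (cellSeen-≡ a y z (dz z))
    rowSeen-≡ a y z exact = inj₂ (at₂-tab₂ (λ x z → f x y z) a z)

    seen : Ix → Plane
    seen a = zip6 (rowSeen a zs) ix ys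

    at-seen : ∀ a y → at (seen a) y ≡ rowSeen a zs y (at ys y)
    at-seen a y = trans (at-zip6 (rowSeen a zs) ix ys y) (cong (λ i → rowSeen a zs i (at ys y)) (at-ix y))

    seen-≡ : ∀ a y z → at (at (seen a) y) z ≡ c0 ⊎ at (at (seen a) y) z ≡ f a y z
    seen-≡ a y z = subst (λ r → at r z ≡ c0 ⊎ at r z ≡ f a y z) (sym (at-seen a y)) (rowSeen-≡ a y z (dy y))

    compatible : ∀ {c u v} → c ≡ c0 ⊎ c ≡ u → okC u v ≡ true → okC c v ≡ true
    compatible (inj₁ refl) _ = refl
    compatible (inj₂ refl) q = q

    allowed-cell : ∀ a y z → allowed (f a y z) (at (colBlocks y (seen a) (rowBlocks (at (seen a) y))) z) ≡ true
    allowed-cell a y z = allowed-colBlocks y (seen a) (rowBlocks (at (seen a) y)) z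
      (λ y′ q → compatible (seen-≡ a y′ z) (proj₂ (proj₁ p a) z y′ y q))
      (allowed-rowBlocks (at (seen a) y) z (λ z′ q → compatible (seen-≡ a y z′) (proj₁ (proj₁ p a) y z′ z q)))

    fits-open : ∀ a y z → at ys y ≡ big →
                Fits (at (openRow (at (seen a) y) zs (colBlocks y (seen a) (rowBlocks (at (seen a) y)))) z) (f a y z)
    fits-open a y z e = subst (λ c → Fits c (f a y z)) (sym (trans
        (at-zip6 (λ f b → f b) (zip6 cell (at (seen a) y) zs) bs z)
        (cong (λ h → h (at bs z)) (at-zip6 cell (at (seen a) y) zs z)))) (go (at zs z) (dz z) refl)
      where
      bs : Six Blocked
      bs = colBlocks y (seen a) (rowBlocks (at (seen a) y))
      go : ∀ L → Describes L (λ x y → f x y z) → L ≡ at zs z → Fits (cell (at (at (seen a) y) z) L (at bs z)) (f a y z)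
      go big vague _ = open′ (allowed-cell a y z)
      go (layer _) exact eq = subst (λ c → Fits (known c) (f a y z)) (sym known-cell) known
        where
        known-cell : at (at (seen a) y) z ≡ f a y z
        known-cell = trans (cong (λ r → at r z) (trans (at-seen a y) (cong (rowSeen a zs y) e)))
          (trans (at-map6 (cellSeen a y) zs z)
          (trans (cong (cellSeen a y) (sym eq)) (at₂-tab₂ (λ x y → f x y z) a y)))

    fits-row : ∀ a y z L → Describes L (λ x z → f x y z) → L ≡ at ys y →
               Fits (at (rowCells (seen a) zs y L) z) (f a y z)
    fits-row a y z big vague eq = fits-open a y z (sym eq)
    fits-row a y z (layer _) exact eq = subst (λ c → Fits c (f a y z))
      (sym (trans (at-map6 known (at (seen a) y) z) (cong known known-cell))) known
      where
      known-cell : at (at (seen a) y) z ≡ f a y z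
      known-cell = trans (cong (λ r → at r z) (trans (at-seen a y) (cong (rowSeen a zs y) (sym eq))))
        (at₂-tab₂ (λ x z → f x y z) a z)

    fits : ∀ a y z {L} → Describes L (f a) → Fits (at (at (cells ys zs a L) y) z) (f a y z)
    fits a y z exact = subst (λ c → Fits c (f a y z))
      (sym (trans (at₂-map6 known (tab₂ (f a)) y z) (cong known (at₂-tab₂ (f a) y z)))) known
    fits a y z vague = subst (λ r → Fits (at r z) (f a y z))
      (sym (trans (at-zip6 (rowCells (seen a) zs) ix ys y) (cong (λ i → rowCells (seen a) zs i (at ys y)) (at-ix y))))
      (fits-row a y z (at ys y) (dy y) refl)

    cs : Six (Six (Six Cell))
    cs = zip6 (cells ys zs) ix xs

    at-cs : ∀ a → at cs a ≡ cells ys zs a (at xs a)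
    at-cs a = trans (at-zip6 (cells ys zs) ix xs a) (cong (λ i → cells ys zs i (at xs a)) (at-ix a))

    fits-cs : ∀ a y z → Fits (at (at (at cs a) y) z) (f a y z)
    fits-cs a y z = subst (λ c → Fits (at (at c y) z) (f a y z)) (sym (at-cs a)) (fits a y z (dx a))

    planes∈ : ∀ a {b} → w₂ (f a) ≤ b → wt (tab₂ (f a)) (w₂ (f a)) ∈ planeFills (at cs a) b
    planes∈ a = ∈-planeFills {c = at cs a} (fits-cs a) (proj₁ p a)

    improve-≤ : ∀ i L {m} → w₃ f ≤ 45 → (∀ a → at m a ≤ w₂ (f a)) → ∀ a → at (improve cs i L m) a ≤ w₂ (f a)
    improve-≤ i (layer _) _ m≤ = m≤
    improve-≤ i big {m} le m≤ = go (total m ≤ᵇ 45)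
      where
      w : Ix → ℕ
      w = w₂ ∘ f
      gap : Ix → ℕ
      gap a = w a ∸ at m a
      Σgap : Σ₆ gap + total m ≡ Σ₆ w
      Σgap = trans (ℕ.+-comm (Σ₆ gap) (total m)) (trans (cong (_+ Σ₆ gap) (total≡ m))
        (trans (sym (Σ₆-distrib-+ (at m) gap)) (Σ₆-cong (λ a → ℕ.m+[n∸m]≡n (m≤ a)))))
      rest : ∀ a → gap a ≤ 45 ∸ total m
      rest a = ℕ.≤-trans (f≤Σ₆ gap a)
        (ℕ.m+n≤o⇒m≤o∸n (Σ₆ gap) (ℕ.≤-trans (ℕ.≤-reflexive Σgap) le))
      -- One layer exceeds its bound by no more than all layers together, hence by at most
      -- `45 ∸ total m`; so the true layer lies within the range that is enumerated.
      enough : w i ≤ at m i + (45 ∸ total m)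
      enough = ℕ.≤-trans (ℕ.≤-reflexive (sym (ℕ.m+[n∸m]≡n (m≤ i)))) (ℕ.+-monoʳ-≤ (at m i) (rest i))
      go : ∀ b → ∀ a → at (if b then update i (lightest (planeFills (at cs i) (at m i + (45 ∸ total m)))) m else m) a ≤ w a
      go false = m≤
      go true  = update-≤ i {m = m} {w} (lightest-≤ {x = wt (tab₂ (f i)) (w i)} (planes∈ i enough)) m≤

    improveAll-≤ : ∀ Xs {m} → w₃ f ≤ 45 → (∀ a → at m a ≤ w₂ (f a)) → ∀ a → at (improveAll cs Xs m) a ≤ w₂ (f a)
    improveAll-≤ (six X₀ X₁ X₂ X₃ X₄ Xₕ) {m} le m≤ =
      improve-≤ i4 X₄ le (improve-≤ i3 X₃ le (improve-≤ i2 X₂ le (improve-≤ i1 X₁ le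
        (improve-≤ i0 X₀ le (improve-≤ hub Xₕ {m} le m≤)))))

  -- The colouring `f` itself would be an element of the list that the test found empty.
  not-refuted : w₃ f ≤ 45 → refuted xs ys zs ≡ true → ⊥
  not-refuted le = nonempty (bounded⁺ okP (improveAll cs xs (map6 lbP cs)) (map6 planeFills cs) {g = tab₂ ∘ f} {w = w₂ ∘ f}
      (improveAll-≤ xs le λ a → subst (_≤ w₂ (f a)) (sym (at-map6 lbP cs a)) (lbP≤w₂ {c = at cs a} (fits-cs a) (proj₁ p a)))
      (λ a {b} q → subst (λ l → wt (tab₂ (f a)) (w₂ (f a)) ∈ l b) (sym (at-map6 planeFills cs a)) (planes∈ a q))
      (planes-wheel p) le)
    where
    nonempty : ∀ {A : Set} {x : A} {l} → x ∈ l → null l ≡ true → ⊥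
    nonempty (here _)  ()
    nonempty (there _) ()

-- The search

having : (Indexed → Six ℕ) → Ix → ℕ → List Indexed → List Indexed
having codes i k = filterᵇ (λ h → at (codes h) i ≡ᵇ k)

layers : List Indexed → List Layer
layers l = map layer l ++ big ∷ []

weighedLayers : List Indexed → List (Weighted Layer)
weighedLayers l = map (λ p → wt (layer p) 0) l ++ wt big 1 ∷ []

data State : Set where
  state : ℕ → Six (List Indexed) → State

isEmpty : {A : Set} → List A → ℕ
isEmpty []      = 1
isEmpty (_ ∷ _) = 0

-- Layer `j` of the second direction and layer `z` of the third share a line: column `z` of the
-- former is column `j` of the latter.
narrow : Ix → Indexed → Six (List Indexed) → Six (List Indexed)
narrow j Y = zip6 (having colCodes j) (colCodes Y)

-- Two uses of the excess of 3. At most three layers of the second direction are `big`; and a layer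
-- of the third direction whose candidate list has become empty must be heavy, so at most three
-- lists may be empty.
stepL : Ix → Layer → State → Maybe State
stepL j big       (state n l) = guard (suc n ≤ᵇ 3) (state (suc n) l)
stepL j (layer Y) (state n l) = go (narrow j Y l)
  where
  go : Six (List Indexed) → Maybe State
  go l = guard (total (map6 isEmpty l) ≤ᵇ 3) (state n l)

-- Up to rotation, two adjacent layers are i0 and i1 or hub and i0.
data Edge : Set where
  rim axis : Edge

source target : Edge → Ix
source rim  = i0
source axis = hub
target rim  = i1
target axis = i0

pair : Edge → Indexed → Indexed → Six Layer
pair rim  X X′ = six (layer X) (layer X′) big big big big
pair axis X X′ = six (layer X′) big big big big (layer X)

module Check (sevens : List Indexed) (e : Edge) where

  -- A `big` layer costs one unit, so the budget 3 again limits the number of heavy layers.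
  zLayers : Six (List Indexed) → List (Weighted (Six Layer))
  zLayers lz = bounded okL (constant 0) (map6 (λ l _ → weighedLayers l) lz) 3

  checkY : Six Layer → Found Layer State → Bool
  checkY xs (found ys (state _ lz)) = all (λ zs → refuted xs ys (item zs)) (zLayers lz)

  -- Layers of the second direction meet `X` and `X′` in rows, those of the third in columns. Seen
  -- from such a layer, both intersections are its rows `source e` and `target e`, so the same
  -- filter serves both directions.
  checkPair : Indexed → Six (List Indexed) → Six (List Indexed) → Indexed → Bool
  checkPair X ly lz X′ = all (checkY (pair e X X′))
    (Search.search okL stepL (map6 layers (zip6 (having rowCodes (target e)) (rowCodes X′) ly))
      (state 0 (zip6 (having rowCodes (target e)) (colCodes X′) lz)))

  check : Indexed → Bool
  check X = all (checkPair X
      (map6 (λ k → having rowCodes (source e) k sevens) (rowCodes X))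
      (map6 (λ k → having rowCodes (source e) k sevens) (colCodes X)))
    (filterᵇ (λ q → okP (plane X) (plane q)) sevens)

-- Soundness of the search

≡ᵇ⁺ : ∀ {m n} → m ≡ n → (m ≡ᵇ n) ≡ true
≡ᵇ⁺ {m} {n} eq = Equivalence.to T-≡ (ℕ.≡⇒≡ᵇ m n eq)

∈-having : ∀ codes i {k h l} → h ∈ l → at (codes h) i ≡ k → h ∈ having codes i k l
∈-having codes i {k} {h} {l} h∈ eq = filter⇒ (λ h → at (codes h) i ≡ᵇ k) h∈ (≡ᵇ⁺ eq)

light : (Ix → Ix → Color) → Bool
light g = w₂ g ≤ᵇ 7

labelOf : Bool → (Ix → Ix → Color) → Layer
labelOf true  g = layer (index (tab₂ g))
labelOf false g = big

label : (Ix → Ix → Color) → Layer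
label g = labelOf (light g) g

excessOf : Bool → ℕ
excessOf b = if b then 0 else 1

excess : (Ix → Ix → Color) → ℕ
excess g = excessOf (light g)

describes : ∀ b g → Describes (labelOf b g) g
describes true  g = exact
describes false g = vague

light⇒ : ∀ g → light g ≡ true → w₂ g ≤ 7
light⇒ g eq = ℕ.≤ᵇ⇒≤ (w₂ g) 7 (Equivalence.from T-≡ eq)

heavy⇒ : ∀ n → (n ≤ᵇ 7) ≡ false → 8 ≤ n
heavy⇒ n eq = [ (λ { (s≤s small) → contradiction (trans (sym eq) (≤⇒≤ᵇ≡true small)) λ () }) , id ]′ (ℕ.<-≤-connex n 8)

okL-label : ∀ b g c h → okP (tab₂ g) (tab₂ h) ≡ true → okL (labelOf b g) (labelOf c h) ≡ true
okL-label true  g true  h ok = ok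
okL-label true  g false h ok = refl
okL-label false g _     h ok = refl

module _ (7≤w₂ : ∀ {g} → Proper₂ g → 7 ≤ w₂ g) where

  7+excess≤w₂ : ∀ {g} → Proper₂ g → 7 + excess g ≤ w₂ g
  7+excess≤w₂ {g} p = go (light g) refl
    where
    go : ∀ b → light g ≡ b → 7 + excessOf b ≤ w₂ g
    go true  _  = 7≤w₂ p
    go false eq = heavy⇒ (w₂ g) eq

  -- Six layers of weight at least 7 use 42 of the 45, and each heavy layer takes at least one unit
  -- more.
  excess≤3 : ∀ {G : Ix → Ix → Ix → Color} → (∀ i → Proper₂ (G i)) → Σ₆ (w₂ ∘ G) ≤ 45 → Σ₆ (excess ∘ G) ≤ 3
  excess≤3 {G} p le = ℕ.+-cancelˡ-≤ 42 (Σ₆ (excess ∘ G)) 3 (ℕ.≤-trans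
    (ℕ.≤-trans (ℕ.≤-reflexive (sym (Σ₆-distrib-+ (λ _ → 7) (excess ∘ G)))) (Σ₆-mono (λ i → 7+excess≤w₂ (p i)))) le)

  module Soundness {sevens : List Indexed} (∈-sevens : ∀ {g} → Proper₂ g → w₂ g ≤ 7 → index (tab₂ g) ∈ sevens)
                   {f : Ix → Ix → Ix → Color} (p : Proper₃ f) (small : w₃ f ≤ 45) (e : Edge) where
    open Check sevens e

    Y Z : Ix → Ix → Ix → Color
    Y y x z = f x y z
    Z z x y = f x y z

    properY : ∀ y → Proper₂ (Y y)
    properY y = (λ x → proj₁ (proj₁ p x) y) , (λ z → proj₂ p y z)

    properZ : ∀ z → Proper₂ (Z z)
    properZ z = (λ x → proj₂ (proj₁ p x) z) , (λ y → proj₂ p y z)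

    ΣY : Σ₆ (w₂ ∘ Y) ≡ w₃ f
    ΣY = Σ₆-comm (λ y x → w₁ (f x y))

    ΣZ : Σ₆ (w₂ ∘ Z) ≡ w₃ f
    ΣZ = trans (Σ₆-comm (λ z x → w₁ (λ y → f x y z))) (Σ₆-cong (λ x → w₂-transpose (f x)))

    wheelY : Wheel okL (label ∘ Y)
    wheelY i j a = okL-label (light (Y i)) (Y i) (light (Y j)) (Y j) (tab₂-ok (Y i) (Y j) λ x z → proj₂ (proj₁ p x) z i j a)

    wheelZ : Wheel okL (label ∘ Z)
    wheelZ i j a = okL-label (light (Z i)) (Z i) (light (Z j)) (Z j) (tab₂-ok (Z i) (Z j) λ x y → proj₁ (proj₁ p x) y i j a)

    Listed : (Ix → Ix → Color) → List Indexed → Set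
    Listed g l = light g ≡ true → index (tab₂ g) ∈ l

    label∈ : ∀ b g {l} → (b ≡ true → index (tab₂ g) ∈ l) → labelOf b g ∈ layers l
    label∈ true  g     q = ∈-++⁺ˡ (∈-map⁺ layer (q refl))
    label∈ false g {l} q = ∈-++⁺ʳ (map layer l) (here refl)

    weighed∈ : ∀ b g {l} → (b ≡ true → index (tab₂ g) ∈ l) → wt (labelOf b g) (excessOf b) ∈ weighedLayers l
    weighed∈ true  g     q = ∈-++⁺ˡ (∈-map⁺ (λ h → wt (layer h) 0) (q refl))
    weighed∈ false g {l} q = ∈-++⁺ʳ (map (λ h → wt (layer h) 0) l) (here refl)

    isEmpty≤excess : ∀ b {h : Indexed} l → (b ≡ true → h ∈ l) → isEmpty l ≤ excessOf b
    isEmpty≤excess false []      _ = s≤s z≤n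
    isEmpty≤excess true  []      q = contradiction (q refl) Any.¬Any[]
    isEmpty≤excess _     (_ ∷ _) _ = z≤n

    -- The candidate lists always retain the true light layers of the third direction; narrowing
    -- respects this because true layers agree where they cross.
    Invariant : Six (List Indexed) → Set
    Invariant l = ∀ z → Listed (Z z) (at l z)

    narrow-invariant : ∀ j {l} → Invariant l → Invariant (narrow j (index (tab₂ (Y j))) l)
    narrow-invariant j {l} inv z q = subst (index (tab₂ (Z z)) ∈_)
      (sym (at-zip6 (having colCodes j) (colCodes (index (tab₂ (Y j)))) l z))
      (∈-having colCodes j (inv z q) (trans (colCodes-index (Z z) j) (sym (colCodes-index (Y j) z))))

    step : ∀ b j {n l} → excessOf b + n ≤ 3 → Invariant l →
           ∃ λ l′ → stepL j (labelOf b (Y j)) (state n l) ≡ just (state (excessOf b + n) l′) × Invariant l′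
    step false j {n} {l} le inv = l , cong (λ b → guard b (state (suc n) l)) (≤⇒≤ᵇ≡true le) , inv
    step true  j {n} {l} le inv = l′ , cong (λ b → guard b (state n l′)) (≤⇒≤ᵇ≡true few) , narrow-invariant j {l} inv
      where
      l′ : Six (List Indexed)
      l′ = narrow j (index (tab₂ (Y j))) l
      few : total (map6 isEmpty l′) ≤ 3
      few = ℕ.≤-trans (ℕ.≤-reflexive (total≡ (map6 isEmpty l′))) (ℕ.≤-trans
        (Σ₆-mono {at (map6 isEmpty l′)} {excess ∘ Z} λ z → ℕ.≤-trans (ℕ.≤-reflexive (at-map6 isEmpty l′ z))
          (isEmpty≤excess (light (Z z)) {index (tab₂ (Z z))} (at l′ z) (narrow-invariant j {l} inv z)))
        (excess≤3 properZ (ℕ.≤-trans (ℕ.≤-reflexive ΣZ) small)))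

    run : ∀ {ly lz} → (∀ y → Listed (Y y) (at ly y)) → Invariant lz →
          ∃ λ n → ∃ λ l → found (tab (label ∘ Y)) (state n l) ∈ Search.search okL stepL (map6 layers ly) (state 0 lz) × Invariant l
    run {ly} {lz} listed inv₀ = _ , proj₁ s₆ , Search.search⁺ okL stepL {l = map6 layers ly} {g = label ∘ Y}
        (λ y → subst (label (Y y) ∈_) (sym (at-map6 layers ly y)) (label∈ (light (Y y)) (Y y) (listed y))) wheelY
        (proj₁ (proj₂ s₁)) (proj₁ (proj₂ s₂)) (proj₁ (proj₂ s₃)) (proj₁ (proj₂ s₄)) (proj₁ (proj₂ s₅)) (proj₁ (proj₂ s₆))
      , proj₂ (proj₂ s₆)
      where
      b : Ix → ℕ
      b = excess ∘ Y
      n₁ n₂ n₃ n₄ n₅ n₆ : ℕ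
      n₁ = b hub + 0
      n₂ = b i0 + n₁
      n₃ = b i1 + n₂
      n₄ = b i2 + n₃
      n₅ = b i3 + n₄
      n₆ = b i4 + n₅
      -- The counts of heavy layers grow along the search, so the bound on the last one gives all
      -- the others.
      l₆ : n₆ ≤ 3
      l₆ = ℕ.≤-trans (ℕ.≤-reflexive (solve 6 (λ h a b c d e →
          e :+ (d :+ (c :+ (b :+ (a :+ (h :+ con 0))))) := h :+ (a :+ (b :+ (c :+ (d :+ e)))))
          refl (b hub) (b i0) (b i1) (b i2) (b i3) (b i4)))
        (excess≤3 properY (ℕ.≤-trans (ℕ.≤-reflexive ΣY) small))
        where
        open import Data.Nat.Solver using (module +-*-Solver)
        open +-*-Solver
      l₅ : n₅ ≤ 3
      l₅ = ℕ.≤-trans (ℕ.m≤n+m n₅ (b i4)) l₆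
      l₄ : n₄ ≤ 3
      l₄ = ℕ.≤-trans (ℕ.m≤n+m n₄ (b i3)) l₅
      l₃ : n₃ ≤ 3
      l₃ = ℕ.≤-trans (ℕ.m≤n+m n₃ (b i2)) l₄
      l₂ : n₂ ≤ 3
      l₂ = ℕ.≤-trans (ℕ.m≤n+m n₂ (b i1)) l₃
      l₁ : n₁ ≤ 3
      l₁ = ℕ.≤-trans (ℕ.m≤n+m n₁ (b i0)) l₂
      s₁ = step (light (Y hub)) hub l₁ inv₀
      s₂ = step (light (Y i0)) i0 l₂ (proj₂ (proj₂ s₁))
      s₃ = step (light (Y i1)) i1 l₃ (proj₂ (proj₂ s₂))
      s₄ = step (light (Y i2)) i2 l₄ (proj₂ (proj₂ s₃))
      s₅ = step (light (Y i3)) i3 l₅ (proj₂ (proj₂ s₄))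
      s₆ = step (light (Y i4)) i4 l₆ (proj₂ (proj₂ s₅))

    ∈-zLayers : ∀ {lz} → Invariant lz → wt (tab (label ∘ Z)) (Σ₆ (excess ∘ Z)) ∈ zLayers lz
    ∈-zLayers {lz} inv = bounded⁺ okL (constant 0) (map6 (λ l _ → weighedLayers l) lz)
      {g = label ∘ Z} {w = excess ∘ Z}
      (λ z → subst (_≤ excess (Z z)) (sym (at-constant 0 z)) z≤n)
      (λ z {b} _ → subst (λ l → wt (label (Z z)) (excess (Z z)) ∈ l b)
        (sym (at-map6 (λ l _ → weighedLayers l) lz z)) (weighed∈ (light (Z z)) (Z z) (inv z)))
      wheelZ (excess≤3 properZ (ℕ.≤-trans (ℕ.≤-reflexive ΣZ) small))

    module _ (l₀ : w₂ (f (source e)) ≤ 7) (l₁ : w₂ (f (target e)) ≤ 7) (edge : adj (source e) (target e) ≡ true) where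

      X X′ : Indexed
      X  = index (tab₂ (f (source e)))
      X′ = index (tab₂ (f (target e)))

      describes-pair : ∀ x → Describes (at (pair e X X′) x) (f x)
      describes-pair = go e (describes true (f (source e))) (describes true (f (target e)))
        where
        go : ∀ e {X X′} → Describes (layer X) (f (source e)) → Describes (layer X′) (f (target e)) →
             ∀ x → Describes (at (pair e X X′) x) (f x)
        go rim  d d′ i0  = d
        go rim  d d′ i1  = d′
        go rim  d d′ i2  = vague
        go rim  d d′ i3  = vague
        go rim  d d′ i4  = vague
        go rim  d d′ hub = vague
        go axis d d′ i0  = d′
        go axis d d′ i1  = vague
        go axis d d′ i2  = vague
        go axis d d′ i3  = vague
        go axis d d′ i4  = vague
        go axis d d′ hub = d

      describes-tab : ∀ (G : Ix → Ix → Ix → Color) i → Describes (at (tab (label ∘ G)) i) (G i)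
      describes-tab G i = subst (λ L → Describes L (G i)) (sym (at-tab (label ∘ G) i)) (describes (light (G i)) (G i))

      ly lz : Six (List Indexed)
      ly = map6 (λ k → having rowCodes (source e) k sevens) (rowCodes X)
      lz = map6 (λ k → having rowCodes (source e) k sevens) (colCodes X)

      listedY : ∀ y → Listed (Y y) (at (zip6 (having rowCodes (target e)) (rowCodes X′) ly) y)
      listedY y q = subst (index (tab₂ (Y y)) ∈_) (sym (at-zip6 (having rowCodes (target e)) (rowCodes X′) ly y))
        (∈-having rowCodes (target e)
          (subst (index (tab₂ (Y y)) ∈_) (sym (at-map6 (λ k → having rowCodes (source e) k sevens) (rowCodes X) y))
            (∈-having rowCodes (source e) (∈-sevens (properY y) (light⇒ (Y y) q))
              (trans (rowCodes-index (Y y) (source e)) (sym (rowCodes-index (f (source e)) y)))))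
          (trans (rowCodes-index (Y y) (target e)) (sym (rowCodes-index (f (target e)) y))))

      listedZ : Invariant (zip6 (having rowCodes (target e)) (colCodes X′) lz)
      listedZ z q = subst (index (tab₂ (Z z)) ∈_) (sym (at-zip6 (having rowCodes (target e)) (colCodes X′) lz z))
        (∈-having rowCodes (target e)
          (subst (index (tab₂ (Z z)) ∈_) (sym (at-map6 (λ k → having rowCodes (source e) k sevens) (colCodes X) z))
            (∈-having rowCodes (source e) (∈-sevens (properZ z) (light⇒ (Z z) q))
              (trans (rowCodes-index (Z z) (source e)) (sym (colCodes-index (f (source e)) z)))))
          (trans (rowCodes-index (Z z) (target e)) (sym (colCodes-index (f (target e)) z))))

      -- The true data survive at every level: `X′` among the planes compatible with `X`, the layers
      -- of the second direction in the search, those of the third in `zLayers`. At that node the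
      -- test claims a refutation, against `not-refuted`.
      check-fails : check X ≡ true → ⊥
      check-fails c = contradict (run {zip6 (having rowCodes (target e)) (rowCodes X′) ly} {zip6 (having rowCodes (target e)) (colCodes X′) lz} listedY listedZ)
        where
        contradict : (∃ λ n → ∃ λ l → found (tab (label ∘ Y)) (state n l) ∈
                        Search.search okL stepL (map6 layers (zip6 (having rowCodes (target e)) (rowCodes X′) ly))
                          (state 0 (zip6 (having rowCodes (target e)) (colCodes X′) lz)) × Invariant l) → ⊥
        contradict (n , l , ys∈ , inv) =
          not-refuted p {pair e X X′} {tab (label ∘ Y)} {tab (label ∘ Z)}
            describes-pair (describes-tab Y) (describes-tab Z) small
            (all⇒ (λ zs → refuted (pair e X X′) (tab (label ∘ Y)) (item zs)) {xs = zLayers l}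
                  {x = wt (tab (label ∘ Z)) (Σ₆ (excess ∘ Z))}
              (all⇒ (checkY (pair e X X′)) {x = found (tab (label ∘ Y)) (state n l)}
                (all⇒ (checkPair X ly lz) {x = X′} c
                  (filter⇒ (λ q → okP (plane X) (plane q)) (∈-sevens (proj₁ p (target e)) l₁)
                    (planes-wheel p (source e) (target e) edge)))
                ys∈)
              (∈-zLayers {l} inv))

-- Two adjacent light layers

bothAt : Six Bool → Automorphism → Edge → Bool
bothAt s α e = at s (Automorphism.to α (source e)) ∧ at s (Automorphism.to α (target e))

adjacentPair? : List Automorphism → List Edge → Six Bool → Bool
adjacentPair? αs es s = any (λ α → any (bothAt s α) es) αs

adjacentPair⇒ : ∀ αs es s → adjacentPair? αs es s ≡ true → ∃ λ α → ∃ λ e → bothAt s α e ≡ true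
adjacentPair⇒ αs es s q with any⇒ (λ α → any (bothAt s α) es) αs q
... | α , _ , q with any⇒ (bothAt s α) es q
... | e , _ , q = α , e , q

fewHeavy? : Six Bool → Bool
fewHeavy? s = total (map6 (λ b → if b then 0 else 1) s) ≤ᵇ 3

both : (Bool → Bool) → Bool
both p = p true ∧ p false

both⇒ : ∀ p → both p ≡ true → ∀ b → p b ≡ true
both⇒ p q true  = proj₁ (∧⁻ {p true} q)
both⇒ p q false = proj₂ (∧⁻ {p true} q)

edges : List Edge
edges = rim ∷ axis ∷ []

-- At least three layers are light, while an independent set of W₅ has at most two vertices. All 64
-- patterns are evaluated, which also yields the rotation that brings the pair to a standard edge.
fewHeavy⇒adjacentPair : ∀ s → not (fewHeavy? s) ∨ adjacentPair? rotations edges s ≡ true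
fewHeavy⇒adjacentPair (six a b c d e h) =
  both⇒ (λ h → p a b c d e h)
  (both⇒ (λ e → both λ h → p a b c d e h)
  (both⇒ (λ d → both λ e → both λ h → p a b c d e h)
  (both⇒ (λ c → both λ d → both λ e → both λ h → p a b c d e h)
  (both⇒ (λ b → both λ c → both λ d → both λ e → both λ h → p a b c d e h)
  (both⇒ (λ a → both λ b → both λ c → both λ d → both λ e → both λ h → p a b c d e h)
  refl a) b) c) d) e) h
  where
  p : (a b c d e h : Bool) → Bool
  p a b c d e h = not (fewHeavy? (six a b c d e h)) ∨ adjacentPair? rotations edges (six a b c d e h)

source-target : ∀ e → adj (source e) (target e) ≡ true
source-target rim  = refl
source-target axis = refl

-- The lower bound from the evaluated tests

module Verification (rs : List Plane) where
  open Representation recolourings dihedral rs using (represented?)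

  checkAll : List Indexed → Bool
  checkAll sevens = all (λ X → Check.check sevens rim X ∧ Check.check sevens axis X) (map index rs)

  -- The three tests supply the bound 7 for every layer, the reduction of a light layer to one in
  -- `rs`, and the exclusion of a light neighbour for each of these.
  verify : List (List Plane) → Bool
  verify pss =
    all (all (λ p → 7 ≤ᵇ wPlane p)) pss ∧
    (all (all represented?) pss ∧ checkAll (map index (concatMap images pss)))

  module _ {pss : List (List Plane)} (∈-pss : ∀ {c} → c ∈ canonicalRows → planesWithHub c ∈ pss)
           (verified : verify pss ≡ true) where
    open HubPlanes ∈-pss

    private
      sevens : List Indexed
      sevens = map index (concatMap images pss)

      parts : all (all (λ p → 7 ≤ᵇ wPlane p)) pss ≡ true × all (all represented?) pss ∧ checkAll sevens ≡ true
      parts = ∧⁻ {all (all (λ p → 7 ≤ᵇ wPlane p)) pss} {all (all represented?) pss ∧ checkAll sevens} verified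

      parts′ : all (all represented?) pss ≡ true × checkAll sevens ≡ true
      parts′ = ∧⁻ {all (all represented?) pss} {checkAll sevens} (proj₂ parts)

      7≤w₂ : ∀ {g} → Proper₂ g → 7 ≤ w₂ g
      7≤w₂ = w₂≥7 (proj₁ parts)

      ∈-sevens : ∀ {g} → Proper₂ g → w₂ g ≤ 7 → index (tab₂ g) ∈ sevens
      ∈-sevens p le = ∈-map⁺ index (∈-all-images p le)

      checkedBoth : ∀ {P} → P ∈ rs → Check.check sevens rim (index P) ≡ true × Check.check sevens axis (index P) ≡ true
      checkedBoth {P} P∈ = ∧⁻ {Check.check sevens rim (index P)} {Check.check sevens axis (index P)}
        (all⇒ (λ X → Check.check sevens rim X ∧ Check.check sevens axis X) {xs = map index rs} {x = index P}
          (proj₂ parts′) (∈-map⁺ index P∈))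

      checked : ∀ {P} → P ∈ rs → ∀ e → Check.check sevens e (index P) ≡ true
      checked P∈ rim  = proj₁ (checkedBoth P∈)
      checked P∈ axis = proj₂ (checkedBoth P∈)

      module _ {f : Ix → Ix → Ix → Color} (p : Proper₃ f) (small : w₃ f ≤ 45) where

        s : Six Bool
        s = tab (light ∘ f)

        Σexcess : total (map6 (λ b → if b then 0 else 1) s) ≤ 3
        Σexcess = excess≤3 7≤w₂ (proj₁ p) small

        adjacent : adjacentPair? rotations edges s ≡ true
        adjacent = subst (λ b → not b ∨ adjacentPair? rotations edges s ≡ true)
          (≤⇒≤ᵇ≡true Σexcess) (fewHeavy⇒adjacentPair s)

        module _ (α : Automorphism) (e : Edge) where
          -- Only the layers of the first direction are permuted here, to move the light pair to the
          -- ends of `e`; the other two directions are adjusted afterwards by `represent`.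
          f₁ : Ix → Ix → Ix → Color
          f₁ = transform₃ identityR α identity identity f

          fails : w₂ (f₁ (source e)) ≤ 7 → w₂ (f₁ (target e)) ≤ 7 → Represented recolourings dihedral rs f₁ (source e) → ⊥
          fails l₀ l₁ r = Soundness.check-fails 7≤w₂ {sevens} ∈-sevens proper
              (ℕ.≤-trans (ℕ.≤-reflexive (trans (Σ₆-cong weight₂) (w₃-transform identityR α identity identity f))) small) e
              (ℕ.≤-trans (ℕ.≤-reflexive (weight₂ (source e))) l₀)
              (ℕ.≤-trans (ℕ.≤-reflexive (weight₂ (target e))) l₁)
              (source-target e) (checked cube∈ e)
            where open Represented r

          lightAt : ∀ i → at s i ≡ true → w₂ (f i) ≤ 7
          lightAt i q = light⇒ (f i) (trans (sym (at-tab (light ∘ f) i)) q)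

          contradictory : at s (Automorphism.to α (source e)) ≡ true × at s (Automorphism.to α (target e)) ≡ true → ⊥
          contradictory (q₀ , q₁) = fails l₀ (lightAt (Automorphism.to α (target e)) q₁)
              (represent recolourings dihedral rs (proj₁ parts′) (proper₃ identityR α identity identity p) (source e) l₀)
            where
            l₀ : w₂ (f₁ (source e)) ≤ 7
            l₀ = lightAt (Automorphism.to α (source e)) q₀

        impossible : (∃ λ α → ∃ λ e → bothAt s α e ≡ true) → ⊥
        impossible (α , e , q) = contradictory α e (∧⁻ {at s (Automorphism.to α (source e))} q)

    46≤w₃ : ∀ {f} → Proper₃ f → 46 ≤ w₃ f
    46≤w₃ {f} p = [ (λ { (s≤s small) → ⊥-elim (impossible p small (adjacentPair⇒ rotations edges s′ (adjacent p small))) }) , id ]′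
      (ℕ.<-≤-connex (w₃ f) 46)
      where
      s′ : Six Bool
      s′ = tab (light ∘ f)

-- Independent sets and partial colourings

∈-subsets : ∀ {n} (S : Subset n) → S ∈ subsets n
∈-subsets [] = here refl
∈-subsets (true  ∷ S) = ∈-++⁺ˡ (∈-map⁺ (inside ∷_) (∈-subsets S))
∈-subsets {suc n} (false ∷ S) = ∈-++⁺ʳ (map (inside ∷_) (subsets n)) (∈-map⁺ (outside ∷_) (∈-subsets S))

α-≡ : (G : Graph) {n : ℕ} (S : Subset (Graph.order G)) → Independent G S → ∣ S ∣ ≡ n →
      (∀ S → Independent G S → ∣ S ∣ ≤ n) → α G ≡ n
α-≡ G {n} S ind refl le = ℕ.≤-antisym
  (max≤v⁺ z≤n (All.map⁺ (All.map (λ {S} → le S) (All.all-filter (independent? G) (subsets _)))))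
  (v≤max⁺ 0 _ (inj₂ (lose (∈-map⁺ ∣_∣ (∈-filter⁺ (independent? G) (∈-subsets S) ind)) ℕ.≤-refl)))

bit : Bool → ℕ
bit true  = 1
bit false = 0

sum : ∀ {n} → (Fin n → ℕ) → ℕ
sum {zero}  f = 0
sum {suc n} f = f zero + sum (f ∘ suc)

sum-cong : ∀ {n} {f g : Fin n → ℕ} → (∀ i → f i ≡ g i) → sum f ≡ sum g
sum-cong {zero}  eq = refl
sum-cong {suc n} eq = cong₂ _+_ (eq zero) (sum-cong (eq ∘ suc))

sum-+ : ∀ m {n} (f : Fin (m + n) → ℕ) → sum f ≡ sum (λ i → f (i ↑ˡ n)) + sum (λ j → f (m ↑ʳ j))
sum-+ zero    f = refl
sum-+ (suc m) f = trans (cong (f zero +_) (sum-+ m (f ∘ suc))) (sym (ℕ.+-assoc (f zero) _ _))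

sum-* : ∀ m {n} (f : Fin (m * n) → ℕ) → sum f ≡ sum (λ i → sum (λ j → f (combine {m} {n} i j)))
sum-* zero        f = refl
sum-* (suc m) {n} f = trans (sum-+ n f) (cong (sum (λ j → f (j ↑ˡ (m * n))) +_) (sum-* m {n} (λ i → f (n ↑ʳ i))))

∣∣≡sum : ∀ {n} (S : Subset n) → ∣ S ∣ ≡ sum (bit ∘ lookup S)
∣∣≡sum [] = refl
∣∣≡sum (true  ∷ S) = cong suc (∣∣≡sum S)
∣∣≡sum (false ∷ S) = ∣∣≡sum S

toFin : Ix → Fin 6
toFin i0  = 0F
toFin i1  = 1F
toFin i2  = 2F
toFin i3  = 3F
toFin i4  = 4F
toFin hub = 5F

toIx : Fin 6 → Ix
toIx 0F = i0
toIx 1F = i1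
toIx 2F = i2
toIx 3F = i3
toIx 4F = i4
toIx 5F = hub

toFin-toIx : ∀ i → toFin (toIx i) ≡ i
toFin-toIx 0F = refl
toFin-toIx 1F = refl
toFin-toIx 2F = refl
toFin-toIx 3F = refl
toFin-toIx 4F = refl
toFin-toIx 5F = refl

toIx-toFin : ∀ i → toIx (toFin i) ≡ i
toIx-toFin i0  = refl
toIx-toFin i1  = refl
toIx-toFin i2  = refl
toIx-toFin i3  = refl
toIx-toFin i4  = refl
toIx-toFin hub = refl

sum≡Σ₆ : (f : Fin 6 → ℕ) → sum f ≡ Σ₆ (f ∘ toFin)
sum≡Σ₆ f = solve 6 (λ a b c d e h → a :+ (b :+ (c :+ (d :+ (e :+ (h :+ con 0))))) := h :+ (a :+ (b :+ (c :+ (d :+ e)))))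
  refl (f 0F) (f 1F) (f 2F) (f 3F) (f 4F) (f 5F)
  where open +-*-Solver

module W = Graph W₅

w : Ix → W.V
w = W.vertex ∘ toFin

private
  adj⇒~′ : ∀ i j → adj (toIx i) (toIx j) ≡ true → W.vertex i W.~ W.vertex j
  adj⇒~′ = toWitness {a? = Fin.all? λ i → Fin.all? λ j →
    (adj (toIx i) (toIx j) Bool.≟ true) →-dec (W.vertex i W.~? W.vertex j)} _

  ~⇒adj′ : ∀ i j → W.vertex i W.~ W.vertex j → adj (toIx i) (toIx j) ≡ true
  ~⇒adj′ = toWitness {a? = Fin.all? λ i → Fin.all? λ j →
    (W.vertex i W.~? W.vertex j) →-dec (adj (toIx i) (toIx j) Bool.≟ true)} _

adj⇒~ : ∀ x y → adj x y ≡ true → w x W.~ w y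
adj⇒~ x y a = adj⇒~′ (toFin x) (toFin y) (subst₂ (λ x y → adj x y ≡ true) (sym (toIx-toFin x)) (sym (toIx-toFin y)) a)

~⇒adj : ∀ x y → w x W.~ w y → adj x y ≡ true
~⇒adj x y a = subst₂ (λ x y → adj x y ≡ true) (toIx-toFin x) (toIx-toFin y) (~⇒adj′ (toFin x) (toFin y) a)

w-injective : ∀ {x y} → w x ≡ w y → x ≡ y
w-injective {x} {y} eq = trans (sym (toIx-toFin x)) (trans (cong toIx
  (trans (sym (Inverse.strictlyInverseˡ W.labels (toFin x)))
  (trans (cong (Inverse.to W.labels) eq) (Inverse.strictlyInverseˡ W.labels (toFin y))))) (toIx-toFin y))

module G = Graph ((W₅ ^□ 3) □ K 3)

lab : Ix → Ix → Ix → Fin 3 → Fin G.order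
lab x y z c = combine {6 * 6 * 6} {3} (combine {6 * 6} {6} (combine {6} {6} (toFin x) (toFin y)) (toFin z)) c

vertex-□ : (H K : Graph) (i : Fin (Graph.order H)) (j : Fin (Graph.order K)) →
           Graph.vertex (H □ K) (combine i j) ≡ (Graph.vertex H i , Graph.vertex K j)
vertex-□ H K i j = cong (λ p → Graph.vertex H (proj₁ p) , Graph.vertex K (proj₂ p)) (Fin.remQuot-combine i j)

vertex-lab : ∀ x y z c → G.vertex (lab x y z c) ≡ (((w x , w y) , w z) , c)
vertex-lab x y z c = trans (vertex-□ ((W₅ □ W₅) □ W₅) (K 3)
    (combine {6 * 6} {6} (combine {6} {6} (toFin x) (toFin y)) (toFin z)) c) (cong (_, c)
  (trans (vertex-□ (W₅ □ W₅) W₅ (combine {6} {6} (toFin x) (toFin y)) (toFin z)) (cong (_, w z) (vertex-□ W₅ W₅ (toFin x) (toFin y)))))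

lab-surjective : ∀ i → ∃ λ x → ∃ λ y → ∃ λ z → ∃ λ c → lab x y z c ≡ i
lab-surjective i = toIx x , toIx y , toIx z , c , (begin
    lab (toIx x) (toIx y) (toIx z) c
      ≡⟨ cong (λ k → combine {6 * 6 * 6} {3} k c) (cong₂ (combine {6 * 6} {6})
           (cong₂ (combine {6} {6}) (toFin-toIx x) (toFin-toIx y)) (toFin-toIx z)) ⟩
    combine {6 * 6 * 6} {3} (combine {6 * 6} {6} (combine {6} {6} x y) z) c
      ≡⟨ cong (λ k → combine {6 * 6 * 6} {3} (combine {6 * 6} {6} k z) c) (Fin.combine-remQuot {6} 6 xy) ⟩
    combine {6 * 6 * 6} {3} (combine {6 * 6} {6} xy z) c
      ≡⟨ cong (λ k → combine {6 * 6 * 6} {3} k c) (Fin.combine-remQuot {6 * 6} 6 xyz) ⟩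
    combine {6 * 6 * 6} {3} xyz c
      ≡⟨ Fin.combine-remQuot {6 * 6 * 6} 3 i ⟩
    i ∎)
  where
  open ≡-Reasoning
  xyz : Fin (6 * 6 * 6)
  xyz = proj₁ (remQuot {6 * 6 * 6} 3 i)
  c : Fin 3
  c = proj₂ (remQuot {6 * 6 * 6} 3 i)
  xy : Fin (6 * 6)
  xy = proj₁ (remQuot {6 * 6} 6 xyz)
  z x y : Fin 6
  z = proj₂ (remQuot {6 * 6} 6 xyz)
  x = proj₁ (remQuot {6} 6 xy)
  y = proj₂ (remQuot {6} 6 xy)

-- The fibre over a vertex of the cube is a triangle; `c1`, `c2`, `c3` name its vertices 0, 1, 2,
-- and `c0` says that none of them belongs to the set.
selects : Color → Fin 3 → Bool
selects c1 0F = true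
selects c2 1F = true
selects c3 2F = true
selects _  _  = false

selects-unique : ∀ v {c d} → selects v c ≡ true → selects v d ≡ true → c ≡ d
selects-unique c1 {0F} {0F} _ _ = refl
selects-unique c2 {1F} {1F} _ _ = refl
selects-unique c3 {2F} {2F} _ _ = refl

selects-not-ok : ∀ u v c → selects u c ≡ true → selects v c ≡ true → okC u v ≡ true → ⊥
selects-not-ok c1 c1 0F _ _ ()
selects-not-ok c2 c2 1F _ _ ()
selects-not-ok c3 c3 2F _ _ ()

Matches : Subset G.order → (Ix → Ix → Ix → Color) → Set
Matches S f = ∀ x y z c → lookup S (lab x y z c) ≡ selects (f x y z) c

-- Each of the 216 fibres contributes exactly 1, either to the set or to the weight.
count : ∀ {S f} → Matches S f → ∣ S ∣ + w₃ f ≡ 216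
count {S} {f} m = trans (cong (_+ w₃ f) size) (trans (sym (Σ₆-distrib-+ (λ x → Σ₆ λ y → Σ₆ λ z → coloured (f x y z)) (w₂ ∘ f)))
  (Σ₆-cong {g = λ _ → 36} λ x → trans (sym (Σ₆-distrib-+ (λ y → Σ₆ λ z → coloured (f x y z)) (w₁ ∘ f x)))
  (Σ₆-cong {g = λ _ → 6} λ y → trans (sym (Σ₆-distrib-+ (λ z → coloured (f x y z)) (wC ∘ f x y)))
  (Σ₆-cong {g = λ _ → 1} λ z → one (f x y z)))))
  where
  coloured : Color → ℕ
  coloured v = sum (bit ∘ selects v)
  one : ∀ v → coloured v + wC v ≡ 1
  one c0 = refl
  one c1 = refl
  one c2 = refl
  one c3 = refl
  s : Fin G.order → ℕ
  s = bit ∘ lookup S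
  cellSum : Fin 6 → Fin 6 → Fin 6 → ℕ
  cellSum x y z = sum {3} λ c → s (combine {6 * 6 * 6} {3} (combine {6 * 6} {6} (combine {6} {6} x y) z) c)
  size : ∣ S ∣ ≡ Σ₆ λ x → Σ₆ λ y → Σ₆ λ z → coloured (f x y z)
  size = begin
    ∣ S ∣                                     ≡⟨ ∣∣≡sum S ⟩
    sum s                                     ≡⟨ sum-* (6 * 6 * 6) {3} s ⟩
    sum {6 * 6 * 6} (λ k → sum {3} λ c → s (combine {6 * 6 * 6} {3} k c))   ≡⟨ sum-* (6 * 6) {6} (λ k → sum {3} λ c → s (combine {6 * 6 * 6} {3} k c)) ⟩
    sum {6 * 6} (λ k → sum {6} λ z → sum {3} λ c → s (combine {6 * 6 * 6} {3} (combine {6 * 6} {6} k z) c))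
      ≡⟨ sum-* 6 {6} (λ k → sum {6} λ z → sum {3} λ c → s (combine {6 * 6 * 6} {3} (combine {6 * 6} {6} k z) c)) ⟩
    sum {6} (λ x → sum {6} λ y → sum {6} λ z → sum {3} λ c → s (combine {6 * 6 * 6} {3} (combine {6 * 6} {6} (combine {6} {6} x y) z) c))
      ≡⟨ trans (sum≡Σ₆ (λ x → sum λ y → sum (cellSum x y))) (Σ₆-cong λ x →
         trans (sum≡Σ₆ (λ y → sum (cellSum (toFin x) y))) (Σ₆-cong λ y →
         trans (sum≡Σ₆ (cellSum (toFin x) (toFin y))) (Σ₆-cong λ z →
           sum-cong {3} λ c → cong bit (m x y z c)))) ⟩
    Σ₆ (λ x → Σ₆ λ y → Σ₆ λ z → coloured (f x y z)) ∎
    where open ≡-Reasoning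

module _ {S : Subset G.order} {f : Ix → Ix → Ix → Color} (m : Matches S f) where

  private
    selected : ∀ x y z c → selects (f x y z) c ≡ true → lab x y z c Sub.∈ S
    selected x y z c e = Vec.lookup⇒[]= (lab x y z c) S (trans (m x y z c) e)

    selected⁻ : ∀ x y z c → lab x y z c Sub.∈ S → selects (f x y z) c ≡ true
    selected⁻ x y z c i∈ = trans (sym (m x y z c)) (Vec.[]=⇒lookup i∈)

    Vertex : Set
    Vertex = ((W.V × W.V) × W.V) × Fin 3

    _≈_ : Vertex → Vertex → Set
    _≈_ = G._~_

  independent⇒proper : Independent ((W₅ ^□ 3) □ K 3) S → Proper₃ f
  independent⇒proper ind =
      (λ x → (λ y i j a → okC-≢ (f x y i) (f x y j) (clash x y i x y j λ c → inj₂ (refl , inj₁ (refl , adj⇒~ i j a))))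
           , (λ z i j a → okC-≢ (f x i z) (f x j z) (clash x i z x j z λ c → inj₂ (refl , inj₂ (refl , inj₁ (refl , adj⇒~ i j a))))))
    , (λ y z i j a → okC-≢ (f i y z) (f j y z) (clash i y z j y z λ c → inj₂ (refl , inj₂ (refl , inj₂ (refl , adj⇒~ i j a)))))
    where
    -- A common colour at adjacent vertices would put two adjacent vertices with the same `K 3`
    -- coordinate into `S`. The colour is a separate argument `v` so that it can be matched on.
    clash′ : ∀ x y z x′ y′ z′ v → f x y z ≡ v → f x′ y′ z′ ≡ v →
             (∀ c → (((w x , w y) , w z) , c) ≈ (((w x′ , w y′) , w z′) , c)) → v ≡ c0
    apart : ∀ x y z x′ y′ z′ c → selects (f x y z) c ≡ true → selects (f x′ y′ z′) c ≡ true →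
            (((w x , w y) , w z) , c) ≈ (((w x′ , w y′) , w z′) , c) → ⊥
    apart x y z x′ y′ z′ c e e′ r = ind (lab x y z c) (selected x y z c e) (lab x′ y′ z′ c) (selected x′ y′ z′ c e′)
      (subst₂ G._~_ (sym (vertex-lab x y z c)) (sym (vertex-lab x′ y′ z′ c)) r)
    clash′ x y z x′ y′ z′ c0 e e′ r = refl
    clash′ x y z x′ y′ z′ c1 e e′ r = ⊥-elim (apart x y z x′ y′ z′ 0F (cong (λ v → selects v 0F) e) (cong (λ v → selects v 0F) e′) (r 0F))
    clash′ x y z x′ y′ z′ c2 e e′ r = ⊥-elim (apart x y z x′ y′ z′ 1F (cong (λ v → selects v 1F) e) (cong (λ v → selects v 1F) e′) (r 1F))
    clash′ x y z x′ y′ z′ c3 e e′ r = ⊥-elim (apart x y z x′ y′ z′ 2F (cong (λ v → selects v 2F) e) (cong (λ v → selects v 2F) e′) (r 2F))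
    clash : ∀ x y z x′ y′ z′ →
            (∀ c → (((w x , w y) , w z) , c) ≈ (((w x′ , w y′) , w z′) , c)) → f x y z ≡ f x′ y′ z′ → f x y z ≡ c0
    clash x y z x′ y′ z′ r eq = clash′ x y z x′ y′ z′ (f x y z) refl (sym eq) r

  proper⇒independent : Proper₃ f → Independent ((W₅ ^□ 3) □ K 3) S
  proper⇒independent p i i∈ j j∈ r = located (lab-surjective i) (lab-surjective j) i∈ j∈ r
    where
    same : ∀ {x y z x′ y′ z′} → x ≡ x′ → y ≡ y′ → z ≡ z′ → f x y z ≡ f x′ y′ z′
    same refl refl refl = refl

    clash : ∀ {u v c} → selects u c ≡ true → selects v c ≡ true → okC u v ≡ true → ⊥
    clash {u} {v} {c} = selects-not-ok u v c

    lineX : ∀ {x y z c x′ y′ z′} → selects (f x y z) c ≡ true → selects (f x′ y′ z′) c ≡ true →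
            y ≡ y′ → z ≡ z′ → w x W.~ w x′ → ⊥
    lineX {x} {y} {z} {x′ = x′} e e′ refl refl a = clash e e′ (proj₂ p y z x x′ (~⇒adj x x′ a))

    lineY : ∀ {x y z c x′ y′ z′} → selects (f x y z) c ≡ true → selects (f x′ y′ z′) c ≡ true →
            x ≡ x′ → z ≡ z′ → w y W.~ w y′ → ⊥
    lineY {x} {y} {z} {y′ = y′} e e′ refl refl a = clash e e′ (proj₂ (proj₁ p x) z y y′ (~⇒adj y y′ a))

    lineZ : ∀ {x y z c x′ y′ z′} → selects (f x y z) c ≡ true → selects (f x′ y′ z′) c ≡ true →
            x ≡ x′ → y ≡ y′ → w z W.~ w z′ → ⊥
    lineZ {x} {y} {z} {z′ = z′} e e′ refl refl a = clash e e′ (proj₁ (proj₁ p x) y z z′ (~⇒adj z z′ a))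

    -- An edge changes exactly one coordinate. The cases are, in turn, the factor `K 3` and the
    -- third, second and first copy of W₅.
    conflict : ∀ x y z c x′ y′ z′ d → selects (f x y z) c ≡ true → selects (f x′ y′ z′) d ≡ true →
               (((w x , w y) , w z) , c) ≈ (((w x′ , w y′) , w z′) , d) → ⊥
    conflict x y z c x′ y′ z′ d e e′ (inj₁ (eq , c≢d)) =
      c≢d (selects-unique (f x y z) e (trans (cong (λ v → selects v d)
        (same (w-injective (cong (proj₁ ∘ proj₁) eq)) (w-injective (cong (proj₂ ∘ proj₁) eq)) (w-injective (cong proj₂ eq)))) e′))
    conflict x y z c x′ y′ z′ _ e e′ (inj₂ (refl , inj₁ (eq , a))) =
      lineZ {x} {y} {z} e e′ (w-injective (cong proj₁ eq)) (w-injective (cong proj₂ eq)) a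
    conflict x y z c x′ y′ z′ _ e e′ (inj₂ (refl , inj₂ (z≡ , inj₁ (x≡ , a)))) =
      lineY {x} {y} {z} e e′ (w-injective x≡) (w-injective z≡) a
    conflict x y z c x′ y′ z′ _ e e′ (inj₂ (refl , inj₂ (z≡ , inj₂ (y≡ , a)))) =
      lineX {x} {y} {z} e e′ (w-injective y≡) (w-injective z≡) a

    located : ∀ {i j} → (∃ λ x → ∃ λ y → ∃ λ z → ∃ λ c → lab x y z c ≡ i) →
              (∃ λ x → ∃ λ y → ∃ λ z → ∃ λ c → lab x y z c ≡ j) →
              i Sub.∈ S → j Sub.∈ S → G.vertex i G.~ G.vertex j → ⊥
    located (x , y , z , c , refl) (x′ , y′ , z′ , d , refl) i∈ j∈ r =
      conflict x y z c x′ y′ z′ d (selected⁻ x y z c i∈) (selected⁻ x′ y′ z′ d j∈)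
        (subst₂ G._~_ (vertex-lab x y z c) (vertex-lab x′ y′ z′ d) r)

-- For an independent set at most one flag is true, since a fibre is a triangle; the precedence
-- among the flags is a convention.
colour : Bool → Bool → Bool → Color
colour true  _     _     = c1
colour false true  _     = c2
colour false false true  = c3
colour false false false = c0

coloring : Subset G.order → Ix → Ix → Ix → Color
coloring S x y z = colour (lookup S (lab x y z 0F)) (lookup S (lab x y z 1F)) (lookup S (lab x y z 2F))

coloring-matches : ∀ {S} → Independent ((W₅ ^□ 3) □ K 3) S → Matches S (coloring S)
coloring-matches {S} ind x y z c = go (lookup S (lab x y z 0F)) (lookup S (lab x y z 1F)) (lookup S (lab x y z 2F)) refl refl refl c
  where
  apart : ∀ {c d} → c ≢ d → lookup S (lab x y z c) ≡ true → lookup S (lab x y z d) ≡ true → ⊥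
  apart {c} {d} c≢d e e′ = ind (lab x y z c) (Vec.lookup⇒[]= (lab x y z c) S e) (lab x y z d) (Vec.lookup⇒[]= (lab x y z d) S e′)
    (subst₂ G._~_ (sym (vertex-lab x y z c)) (sym (vertex-lab x y z d)) (inj₁ (refl , c≢d)))
  go : ∀ a b d → lookup S (lab x y z 0F) ≡ a → lookup S (lab x y z 1F) ≡ b → lookup S (lab x y z 2F) ≡ d →
       ∀ c → lookup S (lab x y z c) ≡ selects (colour a b d) c
  go true true d ea eb _ c = ⊥-elim (apart {0F} {1F} (λ ()) ea eb)
  go true false true ea _ ed c = ⊥-elim (apart {0F} {2F} (λ ()) ea ed)
  go false true true _ eb ed c = ⊥-elim (apart {1F} {2F} (λ ()) eb ed)
  go true  false false ea eb ed 0F = ea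
  go true  false false ea eb ed 1F = eb
  go true  false false ea eb ed 2F = ed
  go false true  false ea eb ed 0F = ea
  go false true  false ea eb ed 1F = eb
  go false true  false ea eb ed 2F = ed
  go false false true  ea eb ed 0F = ea
  go false false true  ea eb ed 1F = eb
  go false false true  ea eb ed 2F = ed
  go false false false ea eb ed 0F = ea
  go false false false ea eb ed 1F = eb
  go false false false ea eb ed 2F = ed

module _ (f : Ix → Ix → Ix → Color) where

  private
    -- A label is decoded one factor at a time, so that each use of `remQuot-combine` rewrites a
    -- single argument.
    chosen₁ : Fin 3 → Fin 6 → Fin 6 × Fin 6 → Bool
    chosen₁ c z (x , y) = selects (f (toIx x) (toIx y) (toIx z)) c

    chosen₂ : Fin 3 → Fin (6 * 6) × Fin 6 → Bool
    chosen₂ c (xy , z) = chosen₁ c z (remQuot {6} 6 xy)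

    chosen₃ : Fin (6 * 6 * 6) × Fin 3 → Bool
    chosen₃ (xyz , c) = chosen₂ c (remQuot {6 * 6} 6 xyz)

  chosenSet : Subset G.order
  chosenSet = tabulate (chosen₃ ∘ remQuot {6 * 6 * 6} 3)

  chosenSet-matches : Matches chosenSet f
  chosenSet-matches x y z c =
    trans (Vec.lookup∘tabulate (chosen₃ ∘ remQuot {6 * 6 * 6} 3) (lab x y z c))
    (trans (cong chosen₃ (Fin.remQuot-combine {6 * 6 * 6} {3} (combine {6 * 6} {6} (combine {6} {6} (toFin x) (toFin y)) (toFin z)) c))
    (trans (cong (chosen₂ c) (Fin.remQuot-combine {6 * 6} {6} (combine {6} {6} (toFin x) (toFin y)) (toFin z)))
    (trans (cong (chosen₁ c (toFin z)) (Fin.remQuot-combine {6} {6} (toFin x) (toFin y)))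
    (cong (λ v → selects v c) (trans (cong (λ x → f x (toIx (toFin y)) (toIx (toFin z))) (toIx-toFin x))
      (cong₂ (f x) (toIx-toFin y) (toIx-toFin z)))))))

α≡170 : (∀ {f} → Proper₃ f → 46 ≤ w₃ f) → (f : Ix → Ix → Ix → Color) → Proper₃ f → w₃ f ≡ 46 → α ((W₅ ^□ 3) □ K 3) ≡ 170
α≡170 bound f p w₃≡46 = α-≡ ((W₅ ^□ 3) □ K 3) (chosenSet f) (proper⇒independent {chosenSet f} {f} m p) size upper
  where
  m : Matches (chosenSet f) f
  m = chosenSet-matches f
  size : ∣ chosenSet f ∣ ≡ 170
  size = ℕ.+-cancelʳ-≡ 46 _ _ (trans (cong (∣ chosenSet f ∣ +_) (sym w₃≡46)) (count {chosenSet f} {f} m))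
  upper : ∀ S → Independent ((W₅ ^□ 3) □ K 3) S → ∣ S ∣ ≤ 170
  upper S ind = ℕ.+-cancelʳ-≤ 46 _ _ (ℕ.≤-trans (ℕ.+-monoʳ-≤ ∣ S ∣ (bound {coloring S} (independent⇒proper {S} {coloring S} (coloring-matches {S} ind) ind)))
    (ℕ.≤-reflexive (count {S} {coloring S} (coloring-matches {S} ind))))

-- Evaluation of the search, and an extremal colouring

hubPlanes : List (List Plane)
hubPlanes = map planesWithHub canonicalRows

-- Checking this `refl` runs the case analysis: the enumeration of the planes, their coverage by the
-- representatives, and both kinds of edge for each of the eleven.
verified : Verification.verify representatives hubPlanes ≡ true
verified = refl

∈-hubPlanes : ∀ {c} → c ∈ canonicalRows → planesWithHub c ∈ hubPlanes
∈-hubPlanes = ∈-map⁺ planesWithHub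

-- The layers have 7, 7, 7, 10, 7 and 8 uncoloured vertices, 46 in all. The first of them is the
-- sixth entry of `representatives`.
optimal : Six Plane
optimal = six
  (six (six c0 c2 c3 c2 c3 c1)
       (six c1 c3 c1 c3 c0 c2)
       (six c3 c2 c3 c0 c1 c0)
       (six c2 c3 c0 c2 c3 c1)
       (six c3 c0 c1 c3 c1 c2)
       (six c0 c1 c2 c1 c2 c3))
  (six (six c2 c1 c2 c1 c0 c3)
       (six c3 c2 c3 c0 c2 c1)
       (six c2 c1 c0 c2 c3 c0)
       (six c1 c0 c2 c1 c2 c3)
       (six c0 c2 c3 c2 c3 c1)
       (six c0 c3 c1 c3 c1 c2))
  (six (six c3 c2 c3 c0 c2 c1)
       (six c1 c3 c0 c2 c3 c0)
       (six c3 c0 c1 c3 c1 c2)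
       (six c0 c2 c3 c2 c3 c1)
       (six c1 c3 c1 c3 c0 c2)
       (six c2 c1 c2 c1 c0 c3))
  (six (six c2 c1 c0 c2 c3 c0)
       (six c3 c0 c1 c3 c1 c2)
       (six c1 c2 c3 c2 c3 c0)
       (six c2 c1 c2 c1 c0 c3)
       (six c3 c2 c3 c0 c1 c0)
       (six c0 c3 c0 c0 c2 c1))
  (six (six c1 c0 c2 c1 c2 c3)
       (six c0 c2 c3 c2 c3 c1)
       (six c2 c1 c2 c1 c0 c3)
       (six c1 c2 c3 c0 c2 c0)
       (six c2 c3 c0 c2 c3 c1)
       (six c3 c0 c1 c3 c1 c2))
  (six (six c0 c3 c1 c3 c1 c2)
       (six c2 c1 c2 c1 c0 c3)
       (six c0 c3 c0 c0 c2 c1)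
       (six c3 c0 c1 c3 c1 c2)
       (six c0 c1 c2 c1 c2 c3)
       (six c1 c2 c3 c2 c3 c0))

proper₁? : (Ix → Color) → Bool
proper₁? r = allIx λ i → allIx λ j → not (adj i j) ∨ okC (r i) (r j)

proper₁?⇒ : ∀ r → proper₁? r ≡ true → Proper₁ r
proper₁?⇒ r q i j a = subst (λ b → not b ∨ okC (r i) (r j) ≡ true) a
  (allIx⇒ (λ j → not (adj i j) ∨ okC (r i) (r j)) (allIx⇒ (λ i → allIx λ j → not (adj i j) ∨ okC (r i) (r j)) q i) j)

lines? : ((Ix → Ix → Ix → Color)) → Bool
lines? f = allIx λ x → allIx λ y → proper₁? (f x y)

lines?⇒ : ∀ f → lines? f ≡ true → ∀ x y → Proper₁ (f x y)
lines?⇒ f q x y = proper₁?⇒ (f x y)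
  (allIx⇒ (λ y → proper₁? (f x y)) (allIx⇒ (λ x → allIx λ y → proper₁? (f x y)) q x) y)

optimalColouring : Ix → Ix → Ix → Color
optimalColouring x y z = at (at (at optimal x) y) z

optimal-proper : Proper₃ optimalColouring
optimal-proper =
    (λ x → lines?⇒ optimalColouring refl x , lines?⇒ (λ x z y → optimalColouring x y z) refl x)
  , lines?⇒ (λ y z x → optimalColouring x y z) refl

theorem1p6 : α ((W₅ ^□ 3) □ K 3) ≡ 170
theorem1p6 = α≡170 (Verification.46≤w₃ representatives ∈-hubPlanes verified)
  optimalColouring optimal-proper refl
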